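{- For every integer $n\ge 1$, \[\overline{p}(5n)\equiv (-1)^n\, r_3(n) \pmod 5.\]
   Context: An overpartition of a nonnegative integer $n$ is a partition of $n$ in which the first occurrence of each distinct part may (or may not) be overlined; $\overline{p}(n)$ denotes the number of overpartitions of $n$ (with $\overline{p}(0)=1$). Equivalently, $\sum_{n\ge0}\overline{p}(n)q^n=\prod_{k\ge1}\frac{1+q^k}{1-q^k}=1/\varphi(-q)$, where $\varphi(q)=\sum_{n=-\infty}^{\infty}q^{n^2}$. For an integer $k\ge1$, $r_k(n)$ denotes the number of representations of $n$ as an ordered sum of $k$ squares of integers, i.e. the number of $(x_1,\dots,x_k)\in\mathbb{Z}^k$ with $x_1^2+\cdots+x_k^2=n$. -}

module Defs where

open import Axiom.UniquenessOfIdentityProofs using (module Decidable⇒UIP)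
open import Data.Bool.Base using (Bool; true; false)
open import Data.Fin.Base using (Fin; zero; suc)
open import Data.Integer.Base as ℤ using (ℤ; +_; -[1+_]; ∣_∣)
open import Data.Integer.Divisibility.Signed using (_∣_)
import Data.Integer.Properties as ℤ
open import Data.List.Base using (List; []; _∷_; _++_; map; length; filter; lookup; upTo; cartesianProduct; cartesianProductWith)
import Data.List.Properties as List
open import Data.List.Membership.Propositional using (_∈_)
open import Data.List.Membership.Propositional.Properties using (∈-filter⁺; ∈-filter⁻; ∈-lookup; ∈-upTo⁺; ∈-map⁺; ∈-map⁻; ∈-++⁺ˡ; ∈-++⁺ʳ; ∈-cartesianProduct⁺; ∈-cartesianProductWith⁺; ∈-cartesianProductWith⁻)
import Data.List.Relation.Unary.All as All
open All using (All; []; _∷_)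
import Data.List.Relation.Unary.AllPairs as AllPairs
open AllPairs using ([]; _∷_)
open import Data.List.Relation.Unary.Any as Any using (here; there)
open import Data.List.Relation.Unary.Any.Properties using (lookup-index)
import Data.List.Relation.Unary.Linked as Linked
open Linked using (Linked; linked?)
open import Data.List.Relation.Unary.Unique.Propositional using (Unique)
import Data.List.Relation.Unary.Unique.Propositional.Properties as Unique
open import Data.Nat.Base as ℕ using (ℕ; zero; suc; _≤_; _<_; z≤n; s≤s)
import Data.Nat.Properties as ℕ
open import Data.Nat.ListAction using (sum)
open import Data.Product.Base using (Σ; ∃; _×_; _,_; proj₁; proj₂)
open import Data.Vec.Base as Vec using (Vec; []; _∷_)
import Data.Vec.Properties as Vec
open import Function.Bundles using (_↔_; mk↔ₛ′)
open import Relation.Binary.PropositionalEquality using (_≡_; refl; sym; trans; cong; cong₂)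
open import Relation.Nullary using (¬_; Dec; yes; no; contradiction)
open import Relation.Nullary.Decidable using (map′; _×-dec_)
open import Relation.Unary using (Decidable; Irrelevant)

infix 4 _≡_[mod_]

_≡_[mod_] : ℤ → ℤ → ℕ → Set
a ≡ b [mod m ] = + m ∣ (a ℤ.- b)

-- A part is its size together with a flag that is true when it is overlined.

Part : Set
Part = ℕ × Bool

-- The parts are listed in nonincreasing order, so equal sizes are adjacent and
-- a part is the first occurrence of its size exactly when it is the head of
-- the list or strictly smaller than its predecessor. Any later occurrence
-- must not be overlined.

infix 4 _≽_

data _≽_ : Part → Part → Set where
  smaller : ∀ {a b s t} → b < a → (a , s) ≽ (b , t)
  repeat  : ∀ {a s} → (a , s) ≽ (a , false)

record IsOverpartition (n : ℕ) (ps : List Part) : Set where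
  constructor isOverpartition
  field
    positive : All (λ p → 0 < proj₁ p) ps
    ordered  : Linked _≽_ ps
    total    : sum (map proj₁ ps) ≡ n

Overpartition : ℕ → Set
Overpartition n = ∃ (IsOverpartition n)

sumOfSquares : ∀ {k} → Vec ℤ k → ℤ
sumOfSquares []       = + 0
sumOfSquares (x ∷ xs) = x ℤ.* x ℤ.+ sumOfSquares xs

IsRepresentation : ∀ k → ℕ → Vec ℤ k → Set
IsRepresentation k n xs = sumOfSquares xs ≡ + n

Representation : ℕ → ℕ → Set
Representation k n = ∃ (IsRepresentation k n)

_≽?_ : ∀ p q → Dec (p ≽ q)
(a , s) ≽? (b , t) with b ℕ.<? a | b ℕ.≟ a | t
... | yes b<a | _        | _     = yes (smaller b<a)
... | no  _   | yes refl | false = yes repeat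
... | no  b≮a | yes refl | true  = no λ { (smaller b<a) → b≮a b<a }
... | no  b≮a | no  b≢a  | _     = no λ { (smaller b<a) → b≮a b<a ; repeat → b≢a refl }

isOverpartition? : ∀ n → Decidable (IsOverpartition n)
isOverpartition? n ps = map′
  (λ { (p , o , t) → isOverpartition p o t })
  (λ { (isOverpartition p o t) → p , o , t })
  (All.all? (λ p → 0 ℕ.<? proj₁ p) ps ×-dec (linked? _≽?_ ps ×-dec (sum (map proj₁ ps) ℕ.≟ n)))

isRepresentation? : ∀ k n → Decidable (IsRepresentation k n)
isRepresentation? k n xs = sumOfSquares xs ℤ.≟ + n

module _ {A : Set} where

  listsUpTo : ℕ → List A → List (List A)
  listsUpTo zero    xs = [] ∷ []
  listsUpTo (suc m) xs = [] ∷ cartesianProductWith _∷_ xs (listsUpTo m xs)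

  vectors : ∀ k → List A → List (Vec A k)
  vectors zero    xs = [] ∷ []
  vectors (suc k) xs = cartesianProductWith _∷_ xs (vectors k xs)

partsUpTo : ℕ → List Part
partsUpTo n = cartesianProduct (upTo (suc n)) (false ∷ true ∷ [])

integersUpTo : ℕ → List ℤ
integersUpTo n = map +_ (upTo (suc n)) ++ map -[1+_] (upTo n)

-- p̄ and r count by filtering a finite search space; that nothing is missed or
-- counted twice is p̄-counts and r-counts below.

p̄ : ℕ → ℕ
p̄ n = length (filter (isOverpartition? n) (listsUpTo n (partsUpTo n)))

r : ℕ → ℕ → ℕ
r k n = length (filter (isRepresentation? k n) (vectors k (integersUpTo n)))

module _ {A : Set} where

  lookup-injective : ∀ {xs : List A} → Unique xs → ∀ i j → lookup xs i ≡ lookup xs j → i ≡ j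
  lookup-injective (_ ∷ _)   zero    zero    _  = refl
  lookup-injective (x∉ ∷ _)  zero    (suc j) eq = contradiction eq (All.lookup x∉ (∈-lookup j))
  lookup-injective (x∉ ∷ _)  (suc i) zero    eq = contradiction (sym eq) (All.lookup x∉ (∈-lookup i))
  lookup-injective (_ ∷ xs!) (suc i) (suc j) eq = cong suc (lookup-injective xs! i j eq)

  filter-counts : {P : A → Set} (P? : Decidable P) → Irrelevant P → ∀ {xs} → Unique xs →
                  (∀ {x} → P x → x ∈ xs) → Fin (length (filter P? xs)) ↔ Σ A P
  filter-counts {P} P? irr {xs} xs! complete = mk↔ₛ′ to from to∘from from∘to
    where
    ys = filter P? xs

    ∈ys : ∀ {x} → P x → x ∈ ys
    ∈ys px = ∈-filter⁺ P? (complete px) px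

    to : Fin (length ys) → Σ A P
    to i = lookup ys i , proj₂ (∈-filter⁻ P? {xs = xs} (∈-lookup i))

    from : Σ A P → Fin (length ys)
    from (_ , px) = Any.index (∈ys px)

    Σ-≡ : ∀ {x y} {px : P x} {py : P y} → x ≡ y → _≡_ {A = Σ A P} (x , px) (y , py)
    Σ-≡ refl = cong (_ ,_) (irr _ _)

    to∘from : ∀ y → to (from y) ≡ y
    to∘from (_ , px) = Σ-≡ (sym (lookup-index (∈ys px)))

    from∘to : ∀ i → from (to i) ≡ i
    from∘to i = lookup-injective (Unique.filter⁺ P? xs!) _ _ (sym (lookup-index (∈ys (proj₂ (to i)))))

  listsUpTo-unique : ∀ m {xs : List A} → Unique xs → Unique (listsUpTo m xs)
  listsUpTo-unique zero    xs! = [] ∷ []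
  listsUpTo-unique (suc m) {xs} xs! =
    All.tabulate (λ { v∈ refl → []∉ v∈ })
    ∷ Unique.cartesianProductWith⁺ _∷_ List.∷-injective xs! (listsUpTo-unique m xs!)
    where
    []∉ : ¬ ([] ∈ cartesianProductWith _∷_ xs (listsUpTo m xs))
    []∉ v∈ with ∈-cartesianProductWith⁻ _∷_ xs (listsUpTo m xs) v∈
    ... | _ , _ , _ , _ , ()

  ∈-listsUpTo : ∀ m {xs ys : List A} → All (_∈ xs) ys → length ys ≤ m → ys ∈ listsUpTo m xs
  ∈-listsUpTo zero    []         _       = here refl
  ∈-listsUpTo (suc m) []         _       = here refl
  ∈-listsUpTo (suc m) (y∈ ∷ ys∈) (s≤s l) = there (∈-cartesianProductWith⁺ _∷_ y∈ (∈-listsUpTo m ys∈ l))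

  vectors-unique : ∀ k {xs : List A} → Unique xs → Unique (vectors k xs)
  vectors-unique zero    xs! = [] ∷ []
  vectors-unique (suc k) xs! =
    Unique.cartesianProductWith⁺ _∷_ Vec.∷-injective xs! (vectors-unique k xs!)

partsUpTo-unique : ∀ n → Unique (partsUpTo n)
partsUpTo-unique n = Unique.cartesianProduct⁺ (Unique.upTo⁺ (suc n)) (((λ ()) ∷ []) ∷ [] ∷ [])

∈-partsUpTo : ∀ {n a} s → a ≤ n → (a , s) ∈ partsUpTo n
∈-partsUpTo {n} s a≤n = ∈-cartesianProduct⁺ (∈-upTo⁺ (s≤s a≤n)) (bool∈ s)
  where
  bool∈ : ∀ s → s ∈ false ∷ true ∷ []
  bool∈ false = here refl
  bool∈ true  = there (here refl)

integersUpTo-unique : ∀ n → Unique (integersUpTo n)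
integersUpTo-unique n = Unique.++⁺
  (Unique.map⁺ ℤ.+-injective (Unique.upTo⁺ (suc n)))
  (Unique.map⁺ ℤ.-[1+-injective (Unique.upTo⁺ n))
  λ { (v∈ , w∈) → disjoint (∈-map⁻ +_ v∈) (∈-map⁻ -[1+_] w∈) }
  where
  disjoint : ∀ {v} {xs ys : List ℕ} → (∃ λ x → x ∈ xs × v ≡ + x) → ¬ (∃ λ y → y ∈ ys × v ≡ -[1+ y ])
  disjoint (_ , _ , refl) (_ , _ , ())

∈-integersUpTo : ∀ {n} x → ∣ x ∣ ≤ n → x ∈ integersUpTo n
∈-integersUpTo     (+ a)    a≤n = ∈-++⁺ˡ (∈-map⁺ +_ (∈-upTo⁺ (s≤s a≤n)))
∈-integersUpTo {n} -[1+ a ] a<n = ∈-++⁺ʳ (map +_ (upTo (suc n))) (∈-map⁺ -[1+_] (∈-upTo⁺ a<n))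

≽-irrelevant : ∀ {p q} (u v : p ≽ q) → u ≡ v
≽-irrelevant (smaller x) (smaller y) = cong smaller (ℕ.<-irrelevant x y)
≽-irrelevant (smaller x) repeat      = contradiction x (ℕ.<-irrefl refl)
≽-irrelevant repeat      (smaller y) = contradiction y (ℕ.<-irrefl refl)
≽-irrelevant repeat      repeat      = refl

isOverpartition-irrelevant : ∀ n → Irrelevant (IsOverpartition n)
isOverpartition-irrelevant n (isOverpartition p o t) (isOverpartition p′ o′ t′)
  with refl ← All.irrelevant ℕ.<-irrelevant p p′
     | refl ← Linked.irrelevant ≽-irrelevant o o′
     | refl ← ℕ.≡-irrelevant t t′ = refl

length≤sum : ∀ {ps : List Part} → All (λ p → 0 < proj₁ p) ps → length ps ≤ sum (map proj₁ ps)
length≤sum []         = z≤n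
length≤sum (0<a ∷ ps) = ℕ.+-mono-≤ 0<a (length≤sum ps)

parts≤sum : ∀ (ps : List Part) {n} → sum (map proj₁ ps) ≤ n → All (_∈ partsUpTo n) ps
parts≤sum []             _ = []
parts≤sum ((a , s) ∷ ps) le =
  ∈-partsUpTo s (ℕ.≤-trans (ℕ.m≤m+n a _) le) ∷ parts≤sum ps (ℕ.≤-trans (ℕ.m≤n+m _ a) le)

p̄-counts : ∀ n → Fin (p̄ n) ↔ Overpartition n
p̄-counts n = filter-counts (isOverpartition? n) (isOverpartition-irrelevant n)
  (listsUpTo-unique n (partsUpTo-unique n))
  λ { {ps} (isOverpartition p _ refl) → ∈-listsUpTo n (parts≤sum ps ℕ.≤-refl) (length≤sum p) }

sumOfSquaresℕ : ∀ {k} → Vec ℤ k → ℕ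
sumOfSquaresℕ []       = 0
sumOfSquaresℕ (x ∷ xs) = ∣ x ∣ ℕ.* ∣ x ∣ ℕ.+ sumOfSquaresℕ xs

square-abs : ∀ x → x ℤ.* x ≡ + (∣ x ∣ ℕ.* ∣ x ∣)
square-abs (+ a)    = sym (ℤ.pos-* a a)
square-abs -[1+ a ] = refl

sumOfSquares-ℕ : ∀ {k} (xs : Vec ℤ k) → sumOfSquares xs ≡ + sumOfSquaresℕ xs
sumOfSquares-ℕ []       = refl
sumOfSquares-ℕ (x ∷ xs) = cong₂ ℤ._+_ (square-abs x) (sumOfSquares-ℕ xs)

m≤m*m : ∀ m → m ≤ m ℕ.* m
m≤m*m zero    = z≤n
m≤m*m (suc m) = ℕ.m≤m*n (suc m) (suc m)

∈-vectors : ∀ {k n} (xs : Vec ℤ k) → sumOfSquaresℕ xs ≤ n → xs ∈ vectors k (integersUpTo n)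
∈-vectors []       _  = here refl
∈-vectors (x ∷ xs) le = ∈-cartesianProductWith⁺ _∷_
  (∈-integersUpTo x (ℕ.≤-trans (m≤m*m ∣ x ∣) (ℕ.≤-trans (ℕ.m≤m+n _ _) le)))
  (∈-vectors xs (ℕ.≤-trans (ℕ.m≤n+m _ _) le))

r-counts : ∀ k n → Fin (r k n) ↔ Representation k n
r-counts k n = filter-counts (isRepresentation? k n) (Decidable⇒UIP.≡-irrelevant ℤ._≟_)
  (vectors-unique k (integersUpTo-unique n))
  λ {xs} eq → ∈-vectors xs (ℕ.≤-reflexive (ℤ.+-injective (trans (sym (sumOfSquares-ℕ xs)) eq)))

{-# OPTIONS --safe #-}
module Submission where

-- Let θ = Σ (-1)ⁿ q^{n²} over all integers n, so that (-1)ᵐ r k m is the coefficient of qᵐ in θᵏ, and let P be the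
-- generating function of p̄. Gauss's identity θ P = 1 follows from Shanks's telescoping finite version. Modulo 5 we have
-- θ(q)⁵ = θ(q⁵); hence, writing U for the extraction of the coefficients of q⁵ⁿ,
-- U(P) θ = U(P θ⁵) = U(θ⁴). Finally U(θ⁴) = θ⁴, that is, r 4 (5n) ≡ r 4 n: each of six quaternions π of norm 5
-- (up to right units) gives r 4 n quaternions π u of norm 5n, and a quaternion of norm 5n has either exactly one
-- or, when 5 divides it, all six of the π as left divisors. Multiplying U(P) θ = θ⁴ by P leaves U(P) = θ³.

open import Defs
open import Algebra.Bundles using (CommutativeRing)
import Algebra.Properties.CommutativeSemigroup
import Algebra.Properties.Ring
open import Algebra.Solver.Ring.AlmostCommutativeRing using (fromCommutativeRing; _-Raw-AlmostCommutative⟶_; Induced-equivalence)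
open import Axiom.UniquenessOfIdentityProofs using (module Decidable⇒UIP)
open import Data.Bool.Base using (true; false)
open import Data.Fin.Base using (Fin; zero; toℕ; fromℕ<)
open import Data.Fin.Permutation using (↔⇒≡)
open import Data.Fin.Properties as Fin using (+↔⊎; toℕ-fromℕ<)
open import Data.Integer.Base as ℤ using (ℤ; +_; -[1+_]; ∣_∣; 0ℤ; 1ℤ; -1ℤ; _⊖_; _◃_)
open import Data.Integer.DivMod using (_%ℕ_; _/ℕ_; n%ℕd<d; a≡a%ℕn+[a/ℕn]*n)
open import Data.Integer.Divisibility.Signed as ∣ using (_∣_; divides)
import Data.Integer.Properties as ℤ
open import Data.Integer.Solver using (module +-*-Solver)
open import Data.List.Base using (List; []; _∷_; _∷ʳ_; _++_; map; length; filter; upTo; cartesianProductWith)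
import Data.List.Properties as List
open import Data.List.Relation.Unary.All as All using (All; []; _∷_)
open import Data.List.Relation.Unary.Linked as Linked using (Linked; []; [-]; _∷_)
open import Data.Maybe.Base using (just; nothing)
open import Data.Nat.Base as ℕ using (ℕ; zero; suc; _≤_; _<_; z≤n; s≤s)
import Data.Nat.Divisibility as ℕ
import Data.Nat.DivMod as ℕ
open import Data.Nat.Induction using (<-rec)
open import Data.Nat.ListAction using (sum)
import Data.Nat.Properties as ℕ
import Data.Nat.Solver as ℕ-Solver
open import Data.Product.Base using (Σ; ∃; _×_; _,_; proj₁; proj₂)
open import Data.Sign.Base as Sign using (Sign)
open import Data.Sum.Base using (_⊎_; inj₁; inj₂)
open import Data.Sum.Function.Propositional using (_⊎-↔_)
open import Data.Unit.Base using (⊤; tt)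
open import Data.Vec.Base as Vec using (Vec; []; _∷_)
import Data.Vec.Properties as Vec
open import Data.Vec.Relation.Binary.Pointwise.Inductive as Pointwise using (Pointwise; []; _∷_)
open import Data.Vec.Relation.Unary.All as VecAll using ([]; _∷_)
open import Function.Base using (_∘_)
open import Function.Bundles using (_↔_; mk↔ₛ′; Inverse)
open import Function.Properties.Inverse using (↔-sym; ↔-trans)
open import Level using (Level; 0ℓ)
open import Relation.Binary.Definitions using (WeaklyDecidable; tri<; tri≈; tri>)
open import Relation.Binary.PropositionalEquality as ≡ using (_≡_; _≢_; module ≡-Reasoning)
import Relation.Binary.Reasoning.Setoid
open import Relation.Nullary using (¬_; Dec; yes; no; contradiction)
open import Relation.Nullary.Decidable using (_×-dec_; _→-dec_; toWitness)
open import Relation.Unary using (Decidable; Irrelevant)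

-- Everything except the count of four squares is carried out over an arbitrary commutative ring,
-- specialised at the end to the integers under congruence modulo 5. Neither denominators nor
-- infinite products occur. The factors (1 + qⁱ) / (1 - qⁱ) enter through recurrences that counts of
-- overpartitions with bounded largest part satisfy by removing one part; division by 1 - qⁿ becomes
-- the remark that a series equal to a positive power of q times itself is zero; each coefficient of
-- θ P is read off a finite identity of high enough index.
--
-- The number six is 5 + 1. Modulo 5 the integer quaternions form the 2×2 matrices over the field of
-- five elements, with the norm as determinant. A nonzero singular matrix has a line as its image,
-- and the six π correspond to the six lines of the plane. Counting pairs (π, v) exactly would give
-- 6 r₄(n) = r₄(5n) + 5 r₄(n/5), the last term coming from the v divisible by 5. Since 1 and 6 agree
-- modulo 5, both kinds of v can be treated alike and that term never has to be identified.

-- Formal power series over a commutative ring.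

module PowerSeries {c ℓ : Level} (R : CommutativeRing c ℓ) where

  open CommutativeRing R renaming (Carrier to A)
  open import Relation.Binary.Reasoning.Setoid setoid
  open import Algebra.Properties.CommutativeSemigroup +-commutativeSemigroup using (interchange; x∙yz≈y∙xz)

  Series : Set c
  Series = ℕ → A

  tail : Series → Series
  tail f n = f (suc n)

  infixl 6 _+ˢ_
  infixl 7 _*ˢ_
  infix  4 _≈ˢ_

  _+ˢ_ : Series → Series → Series
  (f +ˢ g) n = f n + g n

  -ˢ_ : Series → Series
  (-ˢ f) n = - f n

  -- The Cauchy product in the form f g = f₀ g + X (tail f) g, which replaces sums over
  -- antidiagonals by recursion on the degree.
  _*ˢ_ : Series → Series → Series
  (f *ˢ g) zero    = f 0 * g 0
  (f *ˢ g) (suc n) = f 0 * g (suc n) + (tail f *ˢ g) n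

  const : A → Series
  const a zero    = a
  const a (suc n) = 0#

  X : Series
  X zero    = 0#
  X (suc n) = const 1# n

  -- A record, so that both series can be inferred from a proof of their equality.
  record _≈ˢ_ (f g : Series) : Set ℓ where
    constructor coefficientwise
    field coefficient : ∀ n → f n ≈ g n

  open _≈ˢ_ public

  -- Coefficient n of a product sees only coefficients up to n of the factors. The bound allows an
  -- infinite series to be exchanged for a finite approximation.
  *ˢ-cong-≤ : ∀ {f f′ g g′} n → (∀ i → i ≤ n → f i ≈ f′ i) → (∀ i → i ≤ n → g i ≈ g′ i) →
              (f *ˢ g) n ≈ (f′ *ˢ g′) n
  *ˢ-cong-≤ zero    p q = *-cong (p 0 z≤n) (q 0 z≤n)
  *ˢ-cong-≤ (suc n) p q = +-cong (*-cong (p 0 z≤n) (q (suc n) ℕ.≤-refl))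
    (*ˢ-cong-≤ n (λ i i≤n → p (suc i) (s≤s i≤n)) (λ i i≤n → q i (ℕ.m≤n⇒m≤1+n i≤n)))

  *ˢ-zeroˡ : ∀ {f} g n → (∀ i → f i ≈ 0#) → (f *ˢ g) n ≈ 0#
  *ˢ-zeroˡ g zero    p = trans (*-congʳ (p 0)) (zeroˡ _)
  *ˢ-zeroˡ g (suc n) p = trans (+-cong (trans (*-congʳ (p 0)) (zeroˡ _)) (*ˢ-zeroˡ g n (λ i → p (suc i)))) (+-identityˡ 0#)

  const-*ˢ : ∀ a g n → (const a *ˢ g) n ≈ a * g n
  const-*ˢ a g zero    = refl
  const-*ˢ a g (suc n) = trans (+-congˡ (*ˢ-zeroˡ g n (λ _ → refl))) (+-identityʳ _)

  *ˢ-distribʳ : ∀ h f g n → ((f +ˢ g) *ˢ h) n ≈ (f *ˢ h) n + (g *ˢ h) n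
  *ˢ-distribʳ h f g zero    = distribʳ (h 0) (f 0) (g 0)
  *ˢ-distribʳ h f g (suc n) = trans
    (+-cong (distribʳ _ _ _) (*ˢ-distribʳ h (tail f) (tail g) n)) (interchange _ _ _ _)

  *ˢ-scaleˡ : ∀ a f g n → ((λ i → a * f i) *ˢ g) n ≈ a * (f *ˢ g) n
  *ˢ-scaleˡ a f g zero    = *-assoc _ _ _
  *ˢ-scaleˡ a f g (suc n) = trans
    (+-cong (*-assoc _ _ _) (*ˢ-scaleˡ a (tail f) g n)) (sym (distribˡ _ _ _))

  -- The defining recursion peels the left factor; this is its mirror image, from which
  -- commutativity follows.
  *ˢ-sucʳ : ∀ f g n → (f *ˢ g) (suc n) ≈ f (suc n) * g 0 + (f *ˢ tail g) n
  *ˢ-sucʳ f g zero    = +-comm _ _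
  *ˢ-sucʳ f g (suc n) = trans (+-congˡ (*ˢ-sucʳ (tail f) g n)) (x∙yz≈y∙xz _ _ _)

  *ˢ-comm : ∀ f g n → (f *ˢ g) n ≈ (g *ˢ f) n
  *ˢ-comm f g zero    = *-comm _ _
  *ˢ-comm f g (suc n) = trans (+-cong (*-comm _ _) (*ˢ-comm (tail f) g n)) (sym (*ˢ-sucʳ g f n))

  *ˢ-assoc : ∀ f g h n → ((f *ˢ g) *ˢ h) n ≈ (f *ˢ (g *ˢ h)) n
  *ˢ-assoc f g h zero    = *-assoc _ _ _
  *ˢ-assoc f g h (suc n) = begin
    f 0 * g 0 * h (suc n) + (((λ i → f 0 * tail g i) +ˢ (tail f *ˢ g)) *ˢ h) n
      ≈⟨ +-cong (*-assoc _ _ _) (*ˢ-distribʳ h _ _ n) ⟩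
    f 0 * (g 0 * h (suc n)) + (((λ i → f 0 * tail g i) *ˢ h) n + ((tail f *ˢ g) *ˢ h) n)
      ≈⟨ +-congˡ (+-cong (*ˢ-scaleˡ (f 0) (tail g) h n) (*ˢ-assoc (tail f) g h n)) ⟩
    f 0 * (g 0 * h (suc n)) + (f 0 * (tail g *ˢ h) n + (tail f *ˢ (g *ˢ h)) n)
      ≈⟨ +-assoc _ _ _ ⟨
    f 0 * (g 0 * h (suc n)) + f 0 * (tail g *ˢ h) n + (tail f *ˢ (g *ˢ h)) n
      ≈⟨ +-congʳ (distribˡ _ _ _) ⟨
    f 0 * (g *ˢ h) (suc n) + (tail f *ˢ (g *ˢ h)) n ∎

  *ˢ-identityˡ : ∀ f n → (const 1# *ˢ f) n ≈ f n
  *ˢ-identityˡ f n = trans (const-*ˢ 1# f n) (*-identityˡ _)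

  seriesRing : CommutativeRing c ℓ
  seriesRing = record
    { Carrier = Series ; _≈_ = _≈ˢ_ ; _+_ = _+ˢ_ ; _*_ = _*ˢ_ ; -_ = -ˢ_
    ; 0# = λ _ → 0# ; 1# = const 1#
    ; isCommutativeRing = record
      { isRing = record
        { +-isAbelianGroup = record
          { isGroup = record
            { isMonoid = record
              { isSemigroup = record
                { isMagma = record
                  { isEquivalence = record
                    { refl  = coefficientwise λ _ → refl
                    ; sym   = λ p → coefficientwise λ n → sym (coefficient p n)
                    ; trans = λ p q → coefficientwise λ n → trans (coefficient p n) (coefficient q n)
                    }
                  ; ∙-cong = λ p q → coefficientwise λ n → +-cong (coefficient p n) (coefficient q n)
                  }
                ; assoc = λ f g h → coefficientwise λ n → +-assoc _ _ _
                }
              ; identity = (λ f → coefficientwise λ n → +-identityˡ _) , (λ f → coefficientwise λ n → +-identityʳ _)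
              }
            ; inverse = (λ f → coefficientwise λ n → -‿inverseˡ _) , (λ f → coefficientwise λ n → -‿inverseʳ _)
            ; ⁻¹-cong = λ p → coefficientwise λ n → -‿cong (coefficient p n)
            }
          ; comm = λ f g → coefficientwise λ n → +-comm _ _
          }
        ; *-cong = λ p q → coefficientwise λ n → *ˢ-cong-≤ n (λ i _ → coefficient p i) (λ i _ → coefficient q i)
        ; *-assoc = λ f g h → coefficientwise (*ˢ-assoc f g h)
        ; *-identity = (λ f → coefficientwise (*ˢ-identityˡ f)) ,
                       (λ f → coefficientwise λ n → trans (*ˢ-comm f _ n) (*ˢ-identityˡ f n))
        ; distrib = (λ h f g → coefficientwise λ n → trans (*ˢ-comm h _ n)
                       (trans (*ˢ-distribʳ h f g n) (+-cong (*ˢ-comm f h n) (*ˢ-comm g h n)))) ,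
                    (λ h f g → coefficientwise (*ˢ-distribʳ h f g))
        }
      ; *-comm = λ f g → coefficientwise (*ˢ-comm f g)
      }
    }

  private module S = CommutativeRing seriesRing

  open import Algebra.Properties.Semiring.Exp S.semiring public

  const-* : ∀ a b → const (a * b) ≈ˢ const a *ˢ const b
  const-* a b = coefficientwise λ
    { zero    → sym (const-*ˢ a (const b) 0)
    ; (suc n) → sym (trans (const-*ˢ a (const b) (suc n)) (zeroʳ a)) }

  const-cong : ∀ {a b} → a ≈ b → const a ≈ˢ const b
  const-cong p = coefficientwise λ { zero → p ; (suc n) → refl }

  X*-zero : ∀ f → (X *ˢ f) 0 ≈ 0#
  X*-zero f = zeroˡ (f 0)

  X*-suc : ∀ f n → (X *ˢ f) (suc n) ≈ f n
  X*-suc f n = trans (+-cong (zeroˡ _) (*ˢ-identityˡ f n)) (+-identityˡ _)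

  X^*-< : ∀ k f {n} → n < k → (X ^ k *ˢ f) n ≈ 0#
  X^*-< (suc k) f {zero}  _       = trans (*ˢ-assoc X (X ^ k) f 0) (X*-zero (X ^ k *ˢ f))
  X^*-< (suc k) f {suc n} (s≤s p) = trans (*ˢ-assoc X _ f (suc n)) (trans (X*-suc _ n) (X^*-< k f p))

  X^*-+ : ∀ k f n → (X ^ k *ˢ f) (k ℕ.+ n) ≈ f n
  X^*-+ zero    f n = *ˢ-identityˡ f n
  X^*-+ (suc k) f n = trans (*ˢ-assoc X _ f (suc k ℕ.+ n)) (trans (X*-suc _ (k ℕ.+ n)) (X^*-+ k f n))

  head-tail : ∀ f → f ≈ˢ const (f 0) +ˢ X *ˢ tail f
  head-tail f = coefficientwise λ
    { zero    → sym (trans (+-congˡ (X*-zero (tail f))) (+-identityʳ _))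
    ; (suc n) → sym (trans (+-congˡ (X*-suc _ n)) (+-identityˡ _)) }

  -- Such an f is divisible by arbitrarily high powers of X. This serves as cancellation of the
  -- factor 1 - X^(k+1).
  f≈X^[1+k]*f⇒f≈0 : ∀ k f → f ≈ˢ X ^ suc k *ˢ f → ∀ n → f n ≈ 0#
  f≈X^[1+k]*f⇒f≈0 k f eq = <-rec _ step
    where
    step : ∀ n → (∀ {m} → m < n → f m ≈ 0#) → f n ≈ 0#
    step n ih with n ℕ.<? suc k
    ... | yes n<k = trans (coefficient eq n) (X^*-< (suc k) f n<k)
    ... | no  n≮k with m , ≡.refl ← ℕ.m≤n⇒∃[o]m+o≡n (ℕ.≮⇒≥ n≮k) =
      trans (coefficient eq n) (trans (X^*-+ (suc k) f m) (ih (s≤s (ℕ.m≤n+m m k))))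

-- Polynomial identities with integer coefficients in any commutative ring.

module IntegerSolver {c ℓ : Level} (R : CommutativeRing c ℓ) where
  open CommutativeRing R
  open import Algebra.Properties.Ring ring using (-0#≈0#; -‿distribˡ-*; -‿involutive; -‿distribʳ-*; -‿+-comm)
  open import Algebra.Properties.CommutativeSemigroup +-commutativeSemigroup using (interchange)
  open import Algebra.Properties.Semiring.Mult.TCOptimised semiring using (1+×; ×-homo-+; ×1-homo-*) renaming (_×_ to _times_)
  open import Relation.Binary.Reasoning.Setoid setoid

  fromℕ : ℕ → Carrier
  fromℕ n = n times 1#

  private
    fromℤ : ℤ → Carrier
    fromℤ (+ n)    = fromℕ n
    fromℤ -[1+ n ] = - fromℕ (suc n)

    signed : Sign → Carrier → Carrier
    signed Sign.+ x = x
    signed Sign.- x = - x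

    fromℤ-⊖ : ∀ m n → fromℤ (m ⊖ n) ≈ fromℕ m - fromℕ n
    fromℤ-⊖ zero    zero    = sym (-‿inverseʳ 0#)
    fromℤ-⊖ zero    (suc n) = sym (+-identityˡ _)
    fromℤ-⊖ (suc m) zero    = sym (trans (+-congˡ -0#≈0#) (+-identityʳ _))
    fromℤ-⊖ (suc m) (suc n) = begin
      fromℤ (suc m ⊖ suc n)             ≡⟨ ≡.cong fromℤ (ℤ.[1+m]⊖[1+n]≡m⊖n m n) ⟩
      fromℤ (m ⊖ n)                     ≈⟨ fromℤ-⊖ m n ⟩
      fromℕ m - fromℕ n                 ≈⟨ +-identityˡ _ ⟨
      0# + (fromℕ m - fromℕ n)          ≈⟨ +-congʳ (-‿inverseʳ 1#) ⟨
      1# - 1# + (fromℕ m - fromℕ n)     ≈⟨ interchange _ _ _ _ ⟩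
      1# + fromℕ m + (- 1# - fromℕ n)   ≈⟨ +-cong (1+× m 1#) (trans (-‿cong (1+× n 1#)) (sym (-‿+-comm _ _))) ⟨
      fromℕ (suc m) - fromℕ (suc n)     ∎

    fromℤ-+ : ∀ i j → fromℤ (i ℤ.+ j) ≈ fromℤ i + fromℤ j
    fromℤ-+ (+ m)    (+ n)    = ×-homo-+ 1# m n
    fromℤ-+ (+ m)    -[1+ n ] = fromℤ-⊖ m (suc n)
    fromℤ-+ -[1+ m ] (+ n)    = trans (fromℤ-⊖ n (suc m)) (+-comm _ _)
    fromℤ-+ -[1+ m ] -[1+ n ] = begin
      - fromℕ (suc (suc (m ℕ.+ n)))        ≡⟨ ≡.cong (λ k → - fromℕ (suc k)) (≡.sym (ℕ.+-suc m n)) ⟩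
      - fromℕ (suc m ℕ.+ suc n)            ≈⟨ -‿cong (×-homo-+ 1# (suc m) (suc n)) ⟩
      - (fromℕ (suc m) + fromℕ (suc n))    ≈⟨ -‿+-comm _ _ ⟨
      - fromℕ (suc m) - fromℕ (suc n)      ∎

    fromℤ-◃ : ∀ s n → fromℤ (s ◃ n) ≈ signed s (fromℕ n)
    fromℤ-◃ Sign.+ zero    = refl
    fromℤ-◃ Sign.+ (suc n) = refl
    fromℤ-◃ Sign.- zero    = sym -0#≈0#
    fromℤ-◃ Sign.- (suc n) = refl

    fromℤ-* : ∀ i j → fromℤ (i ℤ.* j) ≈ fromℤ i * fromℤ j
    fromℤ-* (+ m)    (+ n)    = trans (fromℤ-◃ Sign.+ (m ℕ.* n)) (×1-homo-* m n)
    fromℤ-* (+ m)    -[1+ n ] = trans (fromℤ-◃ Sign.- (m ℕ.* suc n))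
      (trans (-‿cong (×1-homo-* m (suc n))) (-‿distribʳ-* _ _))
    fromℤ-* -[1+ m ] (+ n)    = trans (fromℤ-◃ Sign.- (suc m ℕ.* n))
      (trans (-‿cong (×1-homo-* (suc m) n)) (-‿distribˡ-* _ _))
    fromℤ-* -[1+ m ] -[1+ n ] = begin
      fromℕ (suc m ℕ.* suc n)              ≈⟨ ×1-homo-* (suc m) (suc n) ⟩
      fromℕ (suc m) * fromℕ (suc n)        ≈⟨ -‿involutive _ ⟨
      - - (fromℕ (suc m) * fromℕ (suc n))  ≈⟨ -‿cong (-‿distribʳ-* _ _) ⟩
      - (fromℕ (suc m) * - fromℕ (suc n))  ≈⟨ -‿distribˡ-* _ _ ⟩
      - fromℕ (suc m) * - fromℕ (suc n)    ∎

    fromℤ-neg : ∀ i → fromℤ (ℤ.- i) ≈ - fromℤ i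
    fromℤ-neg (+ zero)  = sym -0#≈0#
    fromℤ-neg (+ suc n) = refl
    fromℤ-neg -[1+ n ]  = sym (-‿involutive _)

    morphism : CommutativeRing.rawRing ℤ.+-*-commutativeRing -Raw-AlmostCommutative⟶ fromCommutativeRing R
    morphism = record
      { ⟦_⟧ = fromℤ ; +-homo = fromℤ-+ ; *-homo = fromℤ-* ; -‿homo = fromℤ-neg
      ; 0-homo = refl ; 1-homo = refl }

    fromℤ≟ : WeaklyDecidable (Induced-equivalence morphism)
    fromℤ≟ i j with i ℤ.≟ j
    ... | yes i≡j = just (reflexive (≡.cong fromℤ i≡j))
    ... | no  _   = nothing

  open import Algebra.Solver.Ring _ (fromCommutativeRing R) morphism fromℤ≟ public
    using (solve; _:=_; _:+_; _:*_; _:-_; :-_; _:^_; con; Polynomial)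

-- Shanks's finite form of Gauss's identity.

module Shanks {c ℓ : Level} (R : CommutativeRing c ℓ) where
  open CommutativeRing R
  open IntegerSolver R
  open import Algebra.Properties.CommutativeSemiring.Exp commutativeSemiring
  open import Relation.Binary.Reasoning.Setoid setoid

  private
    :1 :2 : ∀ {n} → Polynomial n
    :1 = con (+ 1)
    :2 = con (+ 2)

  sign : ℕ → Carrier
  sign zero    = 1#
  sign (suc n) = - sign n

  sign-+ : ∀ m n → sign (m ℕ.+ n) ≈ sign m * sign n
  sign-+ zero    n = sym (*-identityˡ _)
  sign-+ (suc m) n = trans (-‿cong (sign-+ m n)) (-‿distribˡ-* _ _)
    where open import Algebra.Properties.Ring ring using (-‿distribˡ-*)

  sign*sign : ∀ n → sign n * sign n ≈ 1#
  sign*sign zero    = *-identityˡ 1#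
  sign*sign (suc n) = trans (solve 1 (λ s → :- s :* :- s := s :* s) refl (sign n)) (sign*sign n)

  -- Because n² and n have the same parity, the sign of (-X)^(n²) is the sign (-1)ⁿ of the theta
  -- series.
  sign-square : ∀ n → sign (n ℕ.* n) ≈ sign n
  sign-square zero    = refl
  sign-square (suc n) = -‿cong (begin
    sign (n ℕ.+ n ℕ.* suc n)                ≡⟨ ≡.cong (λ k → sign (n ℕ.+ k)) (ℕ.*-suc n n) ⟩
    sign (n ℕ.+ (n ℕ.+ n ℕ.* n))            ≈⟨ sign-+ n _ ⟩
    sign n * sign (n ℕ.+ n ℕ.* n)           ≈⟨ *-congˡ (sign-+ n _) ⟩
    sign n * (sign n * sign (n ℕ.* n))      ≈⟨ *-assoc _ _ _ ⟨
    sign n * sign n * sign (n ℕ.* n)        ≈⟨ *-cong (sign*sign n) (sign-square n) ⟩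
    1# * sign n                             ≈⟨ *-identityˡ _ ⟩
    sign n                                  ∎)

  partialTheta : Carrier → ℕ → Carrier
  partialTheta x zero    = 1#
  partialTheta x (suc n) = partialTheta x n + sign (suc n) * (fromℕ 2 * x ^ (suc n ℕ.* suc n))

  -- In the notation of the recurrences below, partialTheta x n * O n = shanksSum T n (x ^ suc n).
  shanksSum : (ℕ → Carrier) → ℕ → Carrier → Carrier
  shanksSum T zero    y = 1#
  shanksSum T (suc k) y = shanksSum T k y + sign (suc k) * (fromℕ 2 * (T (suc k) * y ^ suc k))

  -- The recurrences of O n = ∏_{1≤i≤n} (1 + xⁱ) / (1 - xⁱ) and T n = O n / (1 + xⁿ), cleared of denominators.
  module _ (x : Carrier) (O T : ℕ → Carrier)
           (O0≈1 : O 0 ≈ 1#)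
           (O≈ : ∀ n → O (suc n) ≈ T (suc n) + x ^ suc n * T (suc n))
           (T≈ : ∀ n → T (suc n) ≈ O n + x ^ suc n * T (suc n))
    where

    O≈T-xT : ∀ n → O n ≈ T (suc n) - x ^ suc n * T (suc n)
    O≈T-xT n = begin
      O n                                   ≈⟨ solve 2 (λ o u → o := o :+ u :- u) refl (O n) _ ⟩
      O n + x ^ suc n * T (suc n) - x ^ suc n * T (suc n) ≈⟨ +-congʳ (T≈ n) ⟨
      T (suc n) - x ^ suc n * T (suc n)     ∎

    -- As T_k (1 - xᵏ) = O_(k-1) and T_k (1 + xᵏ) = O_k, the k-th summand contributes -2 (-1)ᵏ yᵏ
    -- (O_(k-1) + y O_k), and the alternating sign makes these collapse. Taken at y = x^(n+1), the
    -- identity links the evaluation points x^(n+1) and x^(n+2) of consecutive instances of Shanks's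
    -- identity.
    shanksSum-telescopes : ∀ k y →
      (1# - y) * shanksSum T k (x * y) - (1# + y) * shanksSum T k y ≈ - (sign k * (fromℕ 2 * (O k * y ^ suc k)))
    shanksSum-telescopes zero y = begin
      (1# - y) * 1# - (1# + y) * 1#
        ≈⟨ solve 1 (λ y → (:1 :- y) :* :1 :- (:1 :+ y) :* :1 := :- (:1 :* (:2 :* (:1 :* (y :* :1))))) refl y ⟩
      - (1# * (fromℕ 2 * (1# * (y * 1#))))
        ≈⟨ -‿cong (*-congˡ (*-congˡ (*-congʳ O0≈1))) ⟨
      - (1# * (fromℕ 2 * (O 0 * (y * 1#)))) ∎
    shanksSum-telescopes (suc k) y = begin
      (1# - y) * (a + - e * (fromℕ 2 * (t * (x * y) ^ s))) - (1# + y) * (b + - e * (fromℕ 2 * (t * w)))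
        ≈⟨ +-congʳ (*-congˡ (+-congˡ (*-congˡ (*-congˡ (*-congˡ (^-distrib-* x y s)))))) ⟩
      (1# - y) * (a + - e * (fromℕ 2 * (t * (u * w)))) - (1# + y) * (b + - e * (fromℕ 2 * (t * w)))
        ≈⟨ solve 7 (λ y a b e t u w →
             (:1 :- y) :* (a :+ :- e :* (:2 :* (t :* (u :* w)))) :- (:1 :+ y) :* (b :+ :- e :* (:2 :* (t :* w)))
             := ((:1 :- y) :* a :- (:1 :+ y) :* b) :+ :2 :* (e :* (w :* (t :- u :* t :+ y :* (t :+ u :* t)))))
             refl y a b e t u w ⟩
      ((1# - y) * a - (1# + y) * b) + fromℕ 2 * (e * (w * (t - u * t + y * (t + u * t))))
        ≈⟨ +-congʳ (trans (shanksSum-telescopes k y) (-‿cong (*-congˡ (*-congˡ (*-congʳ (O≈T-xT k)))))) ⟩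
      - (e * (fromℕ 2 * ((t - u * t) * w))) + fromℕ 2 * (e * (w * (t - u * t + y * (t + u * t))))
        ≈⟨ solve 5 (λ y e t u w →
             :- (e :* (:2 :* ((t :- u :* t) :* w))) :+ :2 :* (e :* (w :* (t :- u :* t :+ y :* (t :+ u :* t))))
             := :- (:- e :* (:2 :* ((t :+ u :* t) :* (y :* w)))))
             refl y e t u w ⟩
      - (- e * (fromℕ 2 * ((t + u * t) * (y * w))))
        ≈⟨ -‿cong (*-congˡ (*-congˡ (*-congʳ (O≈ k)))) ⟨
      - (- e * (fromℕ 2 * (O (suc k) * (y * w)))) ∎
      where
      s = suc k
      a = shanksSum T k (x * y)
      b = shanksSum T k y
      e = sign k
      t = T s
      u = x ^ s
      w = y ^ s

    -- The defect d of the next instance satisfies (1 - x^(n+1)) d = 0. An abstract ring does not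
    -- permit cancelling that factor, so the conclusion is kept as d = x^(n+1) d, which forces d = 0
    -- once x is the variable of a power series ring.
    shanks-step : ∀ n → shanksSum T n (x ^ suc n) ≈ partialTheta x n * O n →
      let d = shanksSum T (suc n) (x ^ suc (suc n)) - partialTheta x (suc n) * O (suc n) in d ≈ x ^ suc n * d
    shanks-step n ih = begin
      a + - e * (fromℕ 2 * (t * (x * y) ^ s)) - (h + - e * (fromℕ 2 * x ^ (s ℕ.* s))) * O s
        ≈⟨ d≈ ⟩
      d
        ≈⟨ solve 2 (λ y d → d := y :* d :+ (:1 :- y) :* d) refl y d ⟩
      y * d + (1# - y) * d
        ≈⟨ +-congˡ vanishes ⟩
      y * d + 0#
        ≈⟨ +-identityʳ _ ⟩
      y * d
        ≈⟨ *-congˡ d≈ ⟨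
      y * (a + - e * (fromℕ 2 * (t * (x * y) ^ s)) - (h + - e * (fromℕ 2 * x ^ (s ℕ.* s))) * O s) ∎
      where
      s = suc n
      y = x ^ s
      a = shanksSum T n (x * y)
      b = shanksSum T n y
      h = partialTheta x n
      e = sign n
      t = T s
      w = y ^ s
      -- With y = xˢ one has (x y)ˢ = y w and x^(s²) = w, so the defect becomes a polynomial in a,
      -- h, e, t, y and w.
      d = a + - e * (fromℕ 2 * (t * (y * w))) - (h + - e * (fromℕ 2 * w)) * (t + y * t)

      d≈ : a + - e * (fromℕ 2 * (t * (x * y) ^ s)) - (h + - e * (fromℕ 2 * x ^ (s ℕ.* s))) * O s ≈ d
      d≈ = +-cong (+-congˡ (*-congˡ (*-congˡ (*-congˡ (^-distrib-* x y s)))))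
                  (-‿cong (*-cong (+-congˡ (*-congˡ (*-congˡ (sym (^-assocʳ x s s))))) (O≈ n)))

      vanishes : (1# - y) * d ≈ 0#
      vanishes = begin
        (1# - y) * d
          ≈⟨ solve 7 (λ a b h e t y w →
               (:1 :- y) :* (a :+ :- e :* (:2 :* (t :* (y :* w))) :- (h :+ :- e :* (:2 :* w)) :* (t :+ y :* t))
               := ((:1 :- y) :* a :- (:1 :+ y) :* b) :+ (:1 :+ y) :* b
                  :- (:1 :- y) :* (h :* (t :+ y :* t) :- e :* (:2 :* (t :* w))))
               refl a b h e t y w ⟩
        ((1# - y) * a - (1# + y) * b) + (1# + y) * b - (1# - y) * (h * (t + y * t) - e * (fromℕ 2 * (t * w)))
          ≈⟨ +-congʳ (+-cong
               (trans (shanksSum-telescopes n y) (-‿cong (*-congˡ (*-congˡ (*-congʳ (O≈T-xT n))))))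
               (*-congˡ (trans ih (*-congˡ (O≈T-xT n))))) ⟩
        - (e * (fromℕ 2 * ((t - y * t) * w))) + (1# + y) * (h * (t - y * t))
          - (1# - y) * (h * (t + y * t) - e * (fromℕ 2 * (t * w)))
          ≈⟨ solve 5 (λ h e t y w →
               :- (e :* (:2 :* ((t :- y :* t) :* w))) :+ (:1 :+ y) :* (h :* (t :- y :* t))
               :- (:1 :- y) :* (h :* (t :+ y :* t) :- e :* (:2 :* (t :* w))) := con (+ 0))
               refl h e t y w ⟩
        0# ∎

-- Theta series and representations by squares.

square : ℤ → ℕ
square x = ∣ x ∣ ℕ.* ∣ x ∣

-- Enlarging the box of candidate vectors adds no solutions. One box of size n therefore yields all
-- coefficients up to n at once, and its generating polynomial is a k-th power.
r-≤ : ∀ k {m n} → m ≤ n → length (filter (λ xs → sumOfSquaresℕ xs ℕ.≟ m) (vectors k (integersUpTo n))) ≡ r k m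
r-≤ k {m} {n} m≤n = ≡.trans
  (≡.cong length (List.filter-≐ (λ xs → sumOfSquaresℕ xs ℕ.≟ m) (isRepresentation? k m)
    ((λ {xs} eq → ≡.trans (sumOfSquares-ℕ xs) (≡.cong +_ eq)) , (λ {xs} → rep⇒ xs)) (vectors k (integersUpTo n))))
  (↔⇒≡ (↔-trans
    (filter-counts (isRepresentation? k m) (Decidable⇒UIP.≡-irrelevant ℤ._≟_)
      (vectors-unique k (integersUpTo-unique n))
      (λ {xs} eq → ∈-vectors xs (ℕ.≤-trans (ℕ.≤-reflexive (rep⇒ xs eq)) m≤n)))
    (↔-sym (r-counts k m))))
  where
  rep⇒ : ∀ xs → IsRepresentation k m xs → sumOfSquaresℕ xs ≡ m
  rep⇒ xs eq = ℤ.+-injective (≡.trans (≡.sym (sumOfSquares-ℕ xs)) eq)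

module ThetaSeries {c ℓ : Level} (R : CommutativeRing c ℓ) where
  open CommutativeRing R
  open IntegerSolver R using (fromℕ)
  open PowerSeries R
  open Shanks R using (sign)
  open import Algebra.Properties.Ring ring using (-0#≈0#)
  open import Algebra.Properties.Semiring.Mult.TCOptimised semiring using (1+×)
  open import Relation.Binary.Reasoning.Setoid setoid
  private
    module S = CommutativeRing seriesRing
    module Sh = Shanks seriesRing
    module I = IntegerSolver seriesRing

  module _ (O T : ℕ → Series) (O0≈1 : O 0 ≈ˢ const 1#)
           (O≈ : ∀ n → O (suc n) ≈ˢ T (suc n) +ˢ X ^ suc n *ˢ T (suc n))
           (T≈ : ∀ n → T (suc n) ≈ˢ O n +ˢ X ^ suc n *ˢ T (suc n))
    where

    shanks : ∀ n → Sh.shanksSum T n (X ^ suc n) ≈ˢ Sh.partialTheta X n *ˢ O n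
    shanks zero    = S.sym (S.trans (S.*-identityˡ _) O0≈1)
    shanks (suc n) = x∙y⁻¹≈ε⇒x≈y _ _ (coefficientwise
      (f≈X^[1+k]*f⇒f≈0 n _ (Sh.shanks-step X O T O0≈1 O≈ T≈ n (shanks n))))
      where open import Algebra.Properties.Group S.+-group using (x∙y⁻¹≈ε⇒x≈y)

    -- Each summand after the initial 1 contains a positive power of X^(n+1), hence is invisible
    -- below degree n + 1. The index k is kept apart from n so that the evaluation point stays fixed
    -- during the induction.
    shanksSum-coefficient : ∀ k n m → m ≤ n → Sh.shanksSum T k (X ^ suc n) m ≈ const 1# m
    shanksSum-coefficient zero    n m m≤n = refl
    shanksSum-coefficient (suc k) n m m≤n = trans (+-cong (shanksSum-coefficient k n m m≤n)
      (trans (coefficient y-divides m) (X^*-< (suc n) _ (s≤s m≤n)))) (+-identityʳ _)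
      where
      open I
      y-divides : Sh.sign (suc k) *ˢ (I.fromℕ 2 *ˢ (T (suc k) *ˢ (X ^ suc n) ^ suc k))
                  ≈ˢ X ^ suc n *ˢ (Sh.sign (suc k) *ˢ (I.fromℕ 2 *ˢ (T (suc k) *ˢ (X ^ suc n) ^ k)))
      y-divides = solve 4 (λ s t y w → s :* (con (+ 2) :* (t :* (y :* w))) := y :* (s :* (con (+ 2) :* (t :* w))))
        S.refl _ (T (suc k)) (X ^ suc n) ((X ^ suc n) ^ k)

    -- Coefficient m is read off the finite identity of index m: up to that degree θ and P agree
    -- with the two finite factors, and the other side of the identity agrees with 1.
    gauss : ∀ θ P → (∀ {m n} → m ≤ n → θ m ≈ Sh.partialTheta X n m) → (∀ {m n} → m ≤ n → P m ≈ O n m) →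
            θ *ˢ P ≈ˢ const 1#
    gauss θ P θ≈ P≈ = coefficientwise λ m → begin
      (θ *ˢ P) m                       ≈⟨ *ˢ-cong-≤ m (λ _ → θ≈) (λ _ → P≈) ⟩
      (Sh.partialTheta X m *ˢ O m) m   ≈⟨ coefficient (shanks m) m ⟨
      Sh.shanksSum T m (X ^ suc m) m   ≈⟨ shanksSum-coefficient m m m ℕ.≤-refl ⟩
      const 1# m                       ∎

  monomial : ∀ w → (-ˢ X) ^ w ≈ˢ Sh.sign w *ˢ X ^ w
  monomial zero    = S.sym (S.*-identityˡ _)
  monomial (suc w) = S.trans (S.*-congˡ (monomial w))
    (solve 3 (λ x s y → :- x :* (s :* y) := :- s :* (x :* y)) S.refl X (Sh.sign w) (X ^ w))
    where open I

  monomial-suc : ∀ w m → ((-ˢ X) ^ suc w) (suc m) ≈ - ((-ˢ X) ^ w) m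
  monomial-suc w m = trans (sym (coefficient (S-.-‿distribˡ-* X ((-ˢ X) ^ w)) (suc m))) (-‿cong (X*-suc _ m))
    where module S- = Algebra.Properties.Ring S.ring

  monomial-zero : ∀ w → ((-ˢ X) ^ suc w) 0 ≈ 0#
  monomial-zero w = trans (*-congʳ -0#≈0#) (zeroˡ _)

  monomial-≡ : ∀ w → ((-ˢ X) ^ w) w ≈ sign w
  monomial-≡ zero    = refl
  monomial-≡ (suc w) = trans (monomial-suc w w) (-‿cong (monomial-≡ w))

  monomial-≢ : ∀ w m → w ≢ m → ((-ˢ X) ^ w) m ≈ 0#
  monomial-≢ zero    zero    w≢m = contradiction ≡.refl w≢m
  monomial-≢ zero    (suc m) w≢m = refl
  monomial-≢ (suc w) zero    w≢m = monomial-zero w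
  monomial-≢ (suc w) (suc m) w≢m = trans (monomial-suc w m) (trans (-‿cong (monomial-≢ w m (w≢m ∘ ≡.cong suc))) -0#≈0#)

  module _ {b : Level} {B : Set b} (weight : B → ℕ) where

    -- The base is -X rather than X: the sign (-1)ᵐ then comes with the exponent and is
    -- multiplicative when weights are added.
    generating : List B → Series
    generating []       = S.0#
    generating (x ∷ xs) = (-ˢ X) ^ weight x +ˢ generating xs

    generating-coefficient : ∀ xs m →
      generating xs m ≈ sign m * fromℕ (length (filter (λ x → weight x ℕ.≟ m) xs))
    generating-coefficient []       m = sym (zeroʳ _)
    generating-coefficient (x ∷ xs) m = step (weight x ℕ.≟ m)
      where
      ≟m = λ x → weight x ℕ.≟ m
      k = length (filter ≟m xs)
      step : Dec (weight x ≡ m) → generating (x ∷ xs) m ≈ sign m * fromℕ (length (filter ≟m (x ∷ xs)))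
      step (yes w≡m) = begin
        ((-ˢ X) ^ weight x) m + generating xs m  ≡⟨ ≡.cong (λ w → ((-ˢ X) ^ w) m + generating xs m) w≡m ⟩
        ((-ˢ X) ^ m) m + generating xs m         ≈⟨ +-cong (monomial-≡ m) (generating-coefficient xs m) ⟩
        sign m + sign m * fromℕ k                ≈⟨ +-congʳ (*-identityʳ _) ⟨
        sign m * 1# + sign m * fromℕ k           ≈⟨ distribˡ _ _ _ ⟨
        sign m * (1# + fromℕ k)                  ≈⟨ *-congˡ (1+× k 1#) ⟨
        sign m * fromℕ (suc k)                   ≡⟨ ≡.cong (λ ys → sign m * fromℕ (length ys)) (List.filter-accept ≟m w≡m) ⟨
        sign m * fromℕ (length (filter ≟m (x ∷ xs))) ∎
      step (no w≢m) = begin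
        ((-ˢ X) ^ weight x) m + generating xs m  ≈⟨ +-cong (monomial-≢ _ m w≢m) (generating-coefficient xs m) ⟩
        0# + sign m * fromℕ k                    ≈⟨ +-identityˡ _ ⟩
        sign m * fromℕ k                         ≡⟨ ≡.cong (λ ys → sign m * fromℕ (length ys)) (List.filter-reject ≟m w≢m) ⟨
        sign m * fromℕ (length (filter ≟m (x ∷ xs))) ∎

    generating-++ : ∀ xs ys → generating (xs ++ ys) ≈ˢ generating xs +ˢ generating ys
    generating-++ []       ys = S.sym (S.+-identityˡ _)
    generating-++ (x ∷ xs) ys = S.trans (S.+-congˡ (generating-++ xs ys)) (S.sym (S.+-assoc _ _ _))

    generating-∷ʳ : ∀ xs x → generating (xs ∷ʳ x) ≈ˢ generating xs +ˢ (-ˢ X) ^ weight x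
    generating-∷ʳ xs x = S.trans (generating-++ xs (x ∷ [])) (S.+-congˡ (S.+-identityʳ _))

  generating-map : ∀ {b d : Level} {B : Set b} {D : Set d} (weight : D → ℕ) (f : B → D) xs →
                   generating weight (map f xs) ≈ˢ generating (weight ∘ f) xs
  generating-map weight f []       = S.refl
  generating-map weight f (x ∷ xs) = S.+-congˡ (generating-map weight f xs)

  generating-shift : ∀ {b : Level} {B : Set b} (weight : B → ℕ) k xs →
                     generating (λ x → k ℕ.+ weight x) xs ≈ˢ (-ˢ X) ^ k *ˢ generating weight xs
  generating-shift weight k []       = S.sym (S.zeroʳ _)
  generating-shift weight k (x ∷ xs) = S.trans
    (S.+-cong (^-homo-* (-ˢ X) k (weight x)) (generating-shift weight k xs)) (S.sym (S.distribˡ _ _ _))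

  -- The weight of a vector is the sum of the weights of its entries, so independent choices of
  -- entries multiply the series.
  generating-vectors : ∀ k xs → generating sumOfSquaresℕ (vectors k xs) ≈ˢ generating square xs ^ k
  generating-vectors zero    xs = S.+-identityʳ _
  generating-vectors (suc k) xs = S.trans (product xs) (S.*-congˡ (generating-vectors k xs))
    where
    vs = vectors k xs
    product : ∀ ys → generating sumOfSquaresℕ (cartesianProductWith _∷_ ys vs)
                     ≈ˢ generating square ys *ˢ generating sumOfSquaresℕ vs
    product []       = S.sym (S.zeroˡ _)
    product (y ∷ ys) = S.trans (generating-++ sumOfSquaresℕ (map (y ∷_) vs) _) (S.trans
      (S.+-cong (S.trans (generating-map sumOfSquaresℕ (y ∷_) vs) (generating-shift sumOfSquaresℕ (square y) vs)) (product ys))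
      (S.sym (S.distribʳ _ _ _)))

  generating-integersUpTo : ∀ n → generating square (integersUpTo n) ≈ˢ Sh.partialTheta X n
  generating-integersUpTo n = S.trans (split n) (sums n)
    where
    nonneg neg : ℕ → Series
    nonneg n = generating (λ k → k ℕ.* k) (upTo (suc n))
    neg    n = generating (λ k → suc k ℕ.* suc k) (upTo n)

    split : ∀ n → generating square (integersUpTo n) ≈ˢ nonneg n +ˢ neg n
    split n = S.trans (generating-++ square (map +_ (upTo (suc n))) _)
      (S.+-cong (generating-map square +_ (upTo (suc n))) (generating-map square -[1+_] (upTo n)))

    snoc : ∀ w n → generating w (upTo (suc n)) ≈ˢ generating w (upTo n) +ˢ (-ˢ X) ^ w n
    snoc w n = S.trans (S.reflexive (≡.cong (generating w) (≡.sym (List.upTo-∷ʳ n)))) (generating-∷ʳ w (upTo n) n)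

    sums : ∀ n → nonneg n +ˢ neg n ≈ˢ Sh.partialTheta X n
    -- Passing from n to n + 1 adds the integers n + 1 and -(n + 1). The latter is `-[1+ n ]`, which
    -- explains why the second list is extended at index n; both have weight (n + 1)².
    sums zero    = S.trans (S.+-identityʳ _) (S.+-identityʳ _)
    sums (suc n) = S.trans (S.+-cong (snoc _ (suc n)) (snoc _ n)) (S.trans
      (solve 3 (λ a b z → (a :+ z) :+ (b :+ z) := (a :+ b) :+ con (+ 2) :* z) S.refl
        (nonneg n) (neg n) ((-ˢ X) ^ (suc n ℕ.* suc n)))
      (S.+-cong (sums n) (S.trans
        (S.*-congˡ (S.trans (monomial (suc n ℕ.* suc n)) (S.*-congʳ (Sh.sign-square (suc n)))))
        (solve 2 (λ s z → con (+ 2) :* (s :* z) := s :* (con (+ 2) :* z)) S.refl (Sh.sign (suc n)) (X ^ (suc n ℕ.* suc n))))))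
      where open I

  θ : Series
  θ m = sign m * fromℕ (r 1 m)

  partialTheta-^ : ∀ k {m n} → m ≤ n → (Sh.partialTheta X n ^ k) m ≈ sign m * fromℕ (r k m)
  partialTheta-^ k {m} {n} m≤n = begin
    (Sh.partialTheta X n ^ k) m
      ≈⟨ coefficient (S.trans (generating-vectors k (integersUpTo n)) (^-congˡ k (generating-integersUpTo n))) m ⟨
    generating sumOfSquaresℕ (vectors k (integersUpTo n)) m
      ≈⟨ generating-coefficient sumOfSquaresℕ (vectors k (integersUpTo n)) m ⟩
    sign m * fromℕ (length (filter (λ xs → sumOfSquaresℕ xs ℕ.≟ m) (vectors k (integersUpTo n))))
      ≡⟨ ≡.cong (λ c → sign m * fromℕ c) (r-≤ k m≤n) ⟩
    sign m * fromℕ (r k m) ∎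

  θ≈partialTheta : ∀ {m n} → m ≤ n → θ m ≈ Sh.partialTheta X n m
  θ≈partialTheta {m} {n} m≤n = trans (sym (partialTheta-^ 1 m≤n)) (coefficient (S.*-identityʳ (Sh.partialTheta X n)) m)

  ^-cong-≤ : ∀ k {f g} m → (∀ i → i ≤ m → f i ≈ g i) → (f ^ k) m ≈ (g ^ k) m
  ^-cong-≤ zero    m p = refl
  ^-cong-≤ (suc k) m p = *ˢ-cong-≤ m p (λ i i≤m → ^-cong-≤ k i (λ j j≤i → p j (ℕ.≤-trans j≤i i≤m)))

  θ-^ : ∀ k m → (θ ^ k) m ≈ sign m * fromℕ (r k m)
  θ-^ k m = trans (^-cong-≤ k m (λ _ → θ≈partialTheta)) (partialTheta-^ k ℕ.≤-refl)

-- Fifth powers in characteristic 5 and extraction of every fifth coefficient.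

module Frobenius {c ℓ : Level} (R : CommutativeRing c ℓ) where
  open CommutativeRing R
  open IntegerSolver R
  open import Algebra.Properties.Semiring.Exp semiring
  open import Relation.Binary.Reasoning.Setoid setoid

  ^5-homo-+ : fromℕ 5 ≈ 0# → ∀ x y → (x + y) ^ 5 ≈ x ^ 5 + y ^ 5
  ^5-homo-+ 5≈0 x y = begin
    (x + y) ^ 5
      ≈⟨ solve 2 (λ x y → (x :+ y) :^ 5 := x :^ 5 :+ y :^ 5 :+ con (+ 5) :*
           (x :^ 4 :* y :+ con (+ 2) :* x :^ 3 :* y :^ 2 :+ con (+ 2) :* x :^ 2 :* y :^ 3 :+ x :* y :^ 4)) refl x y ⟩
    x ^ 5 + y ^ 5 + fromℕ 5 * _  ≈⟨ +-congˡ (trans (*-congʳ 5≈0) (zeroˡ _)) ⟩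
    x ^ 5 + y ^ 5 + 0#           ≈⟨ +-identityʳ _ ⟩
    x ^ 5 + y ^ 5                ∎

module Section {c ℓ : Level} (R : CommutativeRing c ℓ) where
  open CommutativeRing R
  open IntegerSolver R using (fromℕ)
  open PowerSeries R
  open import Algebra.Properties.Semiring.Exp semiring using () renaming (_^_ to _^ᴿ_)
  open import Relation.Binary.Reasoning.Setoid setoid
  private
    module S = CommutativeRing seriesRing
    module I = IntegerSolver seriesRing

  section : Series → Series
  section f n = f (5 ℕ.* n)

  section-cong : ∀ {f g} → f ≈ˢ g → section f ≈ˢ section g
  section-cong f≈g = coefficientwise λ n → coefficient f≈g (5 ℕ.* n)

  module _ (5≈0 : fromℕ 5 ≈ 0#) (fermat : ∀ a → a ^ᴿ 5 ≈ a) where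

    5≈0ˢ : I.fromℕ 5 ≈ˢ S.0#
    5≈0ˢ = coefficientwise λ
      { zero    → 5≈0
      ; (suc n) → +0≈0 (+0≈0 (+0≈0 (+-identityʳ 0#))) }
      where
      +0≈0 : ∀ {a} → a ≈ 0# → a + 0# ≈ 0#
      +0≈0 a≈0 = trans (+-identityʳ _) a≈0

    const-^5 : ∀ a → const a ^ 5 ≈ˢ const a
    const-^5 a = S.trans (power 5) (const-cong (fermat a))
      where
      power : ∀ k → const a ^ k ≈ˢ const (a ^ᴿ k)
      power zero    = S.refl
      power (suc k) = S.trans (S.*-congˡ (power k)) (S.sym (const-* a (a ^ᴿ k)))

    -- Write g = g₀ + X (tail g); the fifth power is additive, and g₀⁵ = g₀ by Fermat.
    *-^5-unfold : ∀ f g → f *ˢ g ^ 5 ≈ˢ const (g 0) *ˢ f +ˢ X ^ 5 *ˢ (f *ˢ tail g ^ 5)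
    *-^5-unfold f g = S.trans
      (S.*-congˡ (S.trans (^-congˡ 5 (head-tail g)) (S.trans (Frobenius.^5-homo-+ seriesRing 5≈0ˢ (const (g 0)) (X *ˢ tail g))
        (S.+-congʳ (const-^5 (g 0))))))
      (solve 4 (λ f a x t → f :* (a :+ (x :* t) :^ 5) := a :* f :+ x :^ 5 :* (f :* t :^ 5)) S.refl f (const (g 0)) X (tail g))
      where open I

    -- This is U(f(q) g(q⁵)) = U(f) g, with g⁵ standing in for g(q⁵). No substitution is formed:
    -- each unfolding removes one coefficient of g and lowers the degree by five, matching one step
    -- of the product on the right.
    section-*-^5 : ∀ f g → section (f *ˢ g ^ 5) ≈ˢ section f *ˢ g
    section-*-^5 f g = coefficientwise (go g)
      where
      go : ∀ g n → (f *ˢ g ^ 5) (5 ℕ.* n) ≈ (section f *ˢ g) n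
      go g zero = begin
        (f *ˢ g ^ 5) 0                                       ≈⟨ coefficient (*-^5-unfold f g) 0 ⟩
        g 0 * f 0 + (X ^ 5 *ˢ (f *ˢ tail g ^ 5)) 0           ≈⟨ +-cong (*-comm _ _) (X^*-< 5 (f *ˢ tail g ^ 5) (s≤s z≤n)) ⟩
        f 0 * g 0 + 0#                                       ≈⟨ +-identityʳ _ ⟩
        f 0 * g 0                                            ∎
      go g (suc n) = begin
        (f *ˢ g ^ 5) (5 ℕ.* suc n)
          ≈⟨ coefficient (*-^5-unfold f g) (5 ℕ.* suc n) ⟩
        (const (g 0) *ˢ f) (5 ℕ.* suc n) + (X ^ 5 *ˢ (f *ˢ tail g ^ 5)) (5 ℕ.* suc n)
          ≈⟨ +-cong (trans (const-*ˢ (g 0) f (5 ℕ.* suc n)) (*-comm _ _))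
               (trans (reflexive (≡.cong (X ^ 5 *ˢ (f *ˢ tail g ^ 5)) (ℕ.*-suc 5 n))) (X^*-+ 5 (f *ˢ tail g ^ 5) (5 ℕ.* n))) ⟩
        f (5 ℕ.* suc n) * g 0 + (f *ˢ tail g ^ 5) (5 ℕ.* n)
          ≈⟨ +-congˡ (go (tail g) n) ⟩
        section f (suc n) * g 0 + (section f *ˢ tail g) n
          ≈⟨ *ˢ-sucʳ (section f) g n ⟨
        (section f *ˢ g) (suc n) ∎

-- Overpartitions with bounded largest part.

module Overpartitions where

  open ≡ using (refl)

  -- Ranks the parts as 1 < 1̄ < 2 < 2̄ < …, so that p ≽ q says that q ranks at most as high as p without overline.
  key : Part → ℕ
  key (a , false) = a ℕ.+ a
  key (a , true)  = suc (a ℕ.+ a)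

  private
    doubled-≤ : ∀ {a b} → b < a → suc (b ℕ.+ b) < a ℕ.+ a
    doubled-≤ {a} {b} b<a = ≡.subst (_≤ a ℕ.+ a) (≡.cong suc (ℕ.+-suc b b)) (ℕ.+-mono-≤ b<a b<a)

  key-< : ∀ {a b} s t → b < a → key (b , t) < key (a , s)
  key-< false false b<a = ℕ.<-trans (ℕ.n<1+n _) (doubled-≤ b<a)
  key-< false true  b<a = doubled-≤ b<a
  key-< true  false b<a = ℕ.m≤n⇒m≤1+n (ℕ.<-trans (ℕ.n<1+n _) (doubled-≤ b<a))
  key-< true  true  b<a = ℕ.m≤n⇒m≤1+n (doubled-≤ b<a)

  key-injective : ∀ p q → key p ≡ key q → p ≡ q
  key-injective (a , s) (b , t) eq with ℕ.<-cmp a b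
  ... | tri< a<b _ _ = contradiction eq (ℕ.<⇒≢ (key-< t s a<b))
  ... | tri> _ _ b<a = contradiction (≡.sym eq) (ℕ.<⇒≢ (key-< s t b<a))
  key-injective (a , false) (a , false) eq | tri≈ _ refl _ = refl
  key-injective (a , true)  (a , true)  eq | tri≈ _ refl _ = refl
  key-injective (a , false) (a , true)  eq | tri≈ _ refl _ = contradiction eq (ℕ.1+n≢n ∘ ≡.sym)
  key-injective (a , true)  (a , false) eq | tri≈ _ refl _ = contradiction eq ℕ.1+n≢n

  ≽⇒key≤ : ∀ {p q} → p ≽ q → key q ≤ key (proj₁ p , false)
  ≽⇒key≤ {q = _ , t} (smaller b<a) = ℕ.<⇒≤ (key-< false t b<a)
  ≽⇒key≤ repeat = ℕ.≤-refl

  key≤⇒≽ : ∀ p q → key q ≤ key (proj₁ p , false) → p ≽ q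
  key≤⇒≽ (a , s) (b , t) le with ℕ.<-cmp a b
  ... | tri< a<b _ _ = contradiction (ℕ.<-≤-trans (key-< t false a<b) le) (ℕ.<-irrefl refl)
  ... | tri> _ _ b<a = smaller b<a
  key≤⇒≽ (a , s) (a , false) le | tri≈ _ refl _ = repeat
  key≤⇒≽ (a , s) (a , true)  le | tri≈ _ refl _ = contradiction le ℕ.1+n≰n

  -- In a list linked by `_≽_` the keys never increase, so bounding the head bounds every part. The
  -- empty list meets every bound.
  HeadAtMost : ℕ → List Part → Set
  HeadAtMost k []      = ⊤
  HeadAtMost k (p ∷ _) = key p ≤ k

  headAtMost? : ∀ k → Decidable (HeadAtMost k)
  headAtMost? k []      = yes tt
  headAtMost? k (p ∷ _) = key p ℕ.≤? k

  headAtMost-irrelevant : ∀ k → Irrelevant (HeadAtMost k)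
  headAtMost-irrelevant k {[]}    _ _ = refl
  headAtMost-irrelevant k {_ ∷ _} u v = ℕ.≤-irrelevant u v

  headAtMost-suc : ∀ {k} ps → HeadAtMost k ps → HeadAtMost (suc k) ps
  headAtMost-suc []      _ = tt
  headAtMost-suc (_ ∷ _) u = ℕ.m≤n⇒m≤1+n u

  IsCapped : ℕ → ℕ → List Part → Set
  IsCapped k n ps = HeadAtMost k ps × IsOverpartition n ps

  isCapped? : ∀ k n → Decidable (IsCapped k n)
  isCapped? k n ps = headAtMost? k ps ×-dec isOverpartition? n ps

  isCapped-irrelevant : ∀ k n → Irrelevant (IsCapped k n)
  isCapped-irrelevant k n (u , v) (u′ , v′) = ≡.cong₂ _,_ (headAtMost-irrelevant k u u′) (isOverpartition-irrelevant n v v′)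

  capped : ℕ → ℕ → ℕ
  capped k n = length (filter (isCapped? k n) (listsUpTo n (partsUpTo n)))

  capped-counts : ∀ k n → Fin (capped k n) ↔ ∃ (IsCapped k n)
  capped-counts k n = filter-counts (isCapped? k n) (isCapped-irrelevant k n)
    (listsUpTo-unique n (partsUpTo-unique n))
    λ { {ps} (_ , isOverpartition p _ refl) → ∈-listsUpTo n (parts≤sum ps ℕ.≤-refl) (length≤sum p) }

  Capped-≡ : ∀ {k n} {x y : ∃ (IsCapped k n)} → proj₁ x ≡ proj₁ y → x ≡ y
  Capped-≡ {k} {n} {_ , u} {_ , v} refl = ≡.cong (_ ,_) (isCapped-irrelevant k n u v)

  linked-head : ∀ {p} ps → Linked _≽_ (p ∷ ps) → HeadAtMost (key (proj₁ p , false)) ps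
  linked-head []      _       = tt
  linked-head (_ ∷ _) (u ∷ _) = ≽⇒key≤ u

  linked-∷ : ∀ p ps → HeadAtMost (key (proj₁ p , false)) ps → Linked _≽_ ps → Linked _≽_ (p ∷ ps)
  linked-∷ p []      _ _ = [-]
  linked-∷ p (q ∷ _) u l = key≤⇒≽ p q u ∷ l

  module _ (p : Part) (0<p : 0 < proj₁ p) {k : ℕ} (key≡ : key p ≡ suc k) where

    private a = proj₁ p

    head-is-p : ∀ q {ps} → HeadAtMost (suc k) (q ∷ ps) → ¬ HeadAtMost k (q ∷ ps) → q ≡ p
    head-is-p q u ¬u = key-injective q p (≡.trans (ℕ.≤-antisym u (ℕ.≰⇒> ¬u)) (≡.sym key≡))

    peel : ∀ {m} ps → ¬ HeadAtMost k ps → IsCapped (suc k) (a ℕ.+ m) ps →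
           Σ (∃ (IsCapped (key (a , false)) m)) λ t → ps ≡ p ∷ proj₁ t
    peel []       ¬u _ = contradiction tt ¬u
    peel (q ∷ ps) ¬u (u , isOverpartition (_ ∷ pos) l tot) with refl ← head-is-p q {ps} u ¬u =
      (ps , linked-head ps l , isOverpartition pos (Linked.tail l) (ℕ.+-cancelˡ-≡ a _ _ tot)) , refl

    -- Raising the cap from k to k + 1 admits just the lists headed by p, the unique part of key k +
    -- 1. What follows p is capped by the key of a without overline, whether or not p is overlined,
    -- because a repeated size may not carry an overline.
    capped-split : ∀ m → ∃ (IsCapped (suc k) (a ℕ.+ m)) ↔ (∃ (IsCapped k (a ℕ.+ m)) ⊎ ∃ (IsCapped (key (a , false)) m))
    capped-split m = mk↔ₛ′ to from to∘from from∘to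
      where
      to : ∃ (IsCapped (suc k) (a ℕ.+ m)) → ∃ (IsCapped k (a ℕ.+ m)) ⊎ ∃ (IsCapped (key (a , false)) m)
      to (ps , u , o) with headAtMost? k ps
      ... | yes v = inj₁ (ps , v , o)
      ... | no ¬v = inj₂ (proj₁ (peel ps ¬v (u , o)))

      from : ∃ (IsCapped k (a ℕ.+ m)) ⊎ ∃ (IsCapped (key (a , false)) m) → ∃ (IsCapped (suc k) (a ℕ.+ m))
      from (inj₁ (ps , u , o)) = ps , headAtMost-suc ps u , o
      from (inj₂ (ps , u , isOverpartition pos l tot)) =
        p ∷ ps , ℕ.≤-reflexive key≡ , isOverpartition (0<p ∷ pos) (linked-∷ p ps u l) (≡.cong (a ℕ.+_) tot)

      to∘from : ∀ y → to (from y) ≡ y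
      to∘from (inj₁ (ps , u , o)) with headAtMost? k ps
      ... | yes v = ≡.cong inj₁ (Capped-≡ refl)
      ... | no ¬v = contradiction u ¬v
      to∘from (inj₂ (ps , u , isOverpartition pos l tot)) with headAtMost? k (p ∷ ps)
      ... | yes v = contradiction (≡.subst (_≤ k) key≡ v) ℕ.1+n≰n
      ... | no ¬v = ≡.cong inj₂ (Capped-≡ (≡.sym (List.∷-injectiveʳ (proj₂ (peel (p ∷ ps) ¬v (proj₂ (from (inj₂ (ps , u , isOverpartition pos l tot)))))))))

      from∘to : ∀ x → from (to x) ≡ x
      from∘to (ps , u , o) with headAtMost? k ps
      ... | yes v = Capped-≡ refl
      ... | no ¬v = Capped-≡ (≡.sym (proj₂ (peel ps ¬v (u , o))))

    capped-+ : ∀ m → capped (suc k) (a ℕ.+ m) ≡ capped k (a ℕ.+ m) ℕ.+ capped (key (a , false)) m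
    capped-+ m = ↔⇒≡ (↔-trans (capped-counts (suc k) (a ℕ.+ m)) (↔-trans (capped-split m)
      (↔-trans (↔-sym (capped-counts k (a ℕ.+ m)) ⊎-↔ ↔-sym (capped-counts (key (a , false)) m)) (↔-sym +↔⊎))))

    capped-< : ∀ {n} → n < a → capped (suc k) n ≡ capped k n
    capped-< {n} n<a = ≡.cong length (List.filter-≐ (isCapped? (suc k) n) (isCapped? k n)
      ((λ {ps} → shrink ps) , λ {ps} (u , o) → headAtMost-suc ps u , o) (listsUpTo n (partsUpTo n)))
      where
      shrink : ∀ ps → IsCapped (suc k) n ps → IsCapped k n ps
      shrink [] (_ , o) = tt , o
      shrink (q ∷ ps) (u , o@(isOverpartition _ _ tot)) with headAtMost? k (q ∷ ps)
      ... | yes v = v , o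
      ... | no ¬v with refl ← head-is-p q {ps} u ¬v =
        contradiction (ℕ.≤-<-trans (ℕ.m+n≤o⇒m≤o a (ℕ.≤-reflexive tot)) n<a) (ℕ.<-irrefl refl)

  -- The cap is the key of an overlined part n, and no part of an overpartition of m ≤ n exceeds n.
  p̄≡capped : ∀ {m n} → m ≤ n → p̄ m ≡ capped (suc (n ℕ.+ n)) m
  p̄≡capped {m} {n} m≤n = ≡.cong length (List.filter-≐ (isOverpartition? m) (isCapped? (suc (n ℕ.+ n)) m)
    ((λ {ps} o → head≤ ps o , o) , proj₂) (listsUpTo m (partsUpTo m)))
    where
    head≤ : ∀ ps → IsOverpartition m ps → HeadAtMost (suc (n ℕ.+ n)) ps
    head≤ [] _ = tt
    head≤ ((a , s) ∷ ps) (isOverpartition _ _ tot) = key-≤ s (ℕ.≤-trans (ℕ.m+n≤o⇒m≤o a (ℕ.≤-reflexive tot)) m≤n)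
      where
      key-≤ : ∀ {a} s → a ≤ n → key (a , s) ≤ suc (n ℕ.+ n)
      key-≤ false a≤n = ℕ.m≤n⇒m≤1+n (ℕ.+-mono-≤ a≤n a≤n)
      key-≤ true  a≤n = s≤s (ℕ.+-mono-≤ a≤n a≤n)

  -- Keys 0 and 1 belong to parts of size 0, which are excluded, so only the empty list survives
  -- this cap.
  capped-1-suc : ∀ n → capped 1 (suc n) ≡ 0
  capped-1-suc n = empty (capped 1 (suc n)) (none ∘ Inverse.to (capped-counts 1 (suc n)))
    where
    none : ¬ ∃ (IsCapped 1 (suc n))
    none ([] , _ , isOverpartition _ _ ())
    none ((suc a , s) ∷ ps , u , _) = contradiction (ℕ.<-≤-trans (key-< {suc a} {0} s true (s≤s z≤n)) u) (ℕ.<-irrefl refl)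
    none ((zero , s) ∷ ps , _ , isOverpartition (() ∷ _) _ _)

    empty : ∀ k → ¬ Fin k → k ≡ 0
    empty zero    _ = refl
    empty (suc k) ¬f = contradiction zero ¬f

-- Generating functions of bounded overpartitions.

module OverpartitionSeries {c ℓ : Level} (R : CommutativeRing c ℓ) where
  open CommutativeRing R using (_≈_; 0#; 1#; _+_; +-congˡ; +-identityʳ; refl; trans; sym; reflexive; semiring)
  open IntegerSolver R using (fromℕ)
  open PowerSeries R
  open Overpartitions
  open import Algebra.Properties.Semiring.Mult.TCOptimised semiring using (×-homo-+)

  cappedSeries : ℕ → Series
  cappedSeries k n = fromℕ (capped k n)

  cappedSeries-unfold : ∀ p → 0 < proj₁ p → ∀ {k} → key p ≡ suc k →
    cappedSeries (suc k) ≈ˢ cappedSeries k +ˢ X ^ proj₁ p *ˢ cappedSeries (key (proj₁ p , false))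
  cappedSeries-unfold p@(a , _) 0<a {k} key≡ = coefficientwise go
    where
    go : ∀ n → fromℕ (capped (suc k) n) ≈ fromℕ (capped k n) + (X ^ a *ˢ cappedSeries (a ℕ.+ a)) n
    go n with n ℕ.<? a
    ... | yes n<a = trans (reflexive (≡.cong fromℕ (capped-< p 0<a key≡ n<a)))
      (sym (trans (+-congˡ (X^*-< a _ n<a)) (+-identityʳ _)))
    ... | no n≮a with m , ≡.refl ← ℕ.m≤n⇒∃[o]m+o≡n (ℕ.≮⇒≥ n≮a) =
      trans (reflexive (≡.cong fromℕ (capped-+ p 0<a key≡ m)))
        (trans (×-homo-+ 1# (capped k n) (capped (a ℕ.+ a) m)) (+-congˡ (sym (X^*-+ a (cappedSeries (a ℕ.+ a)) m))))

  -- `O n` allows parts up to n; `T n`, for n ≥ 1, also forbids an overline on n. As products these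
  -- are ∏ (1 + qⁱ) / (1 - qⁱ) over 1 ≤ i ≤ n and its quotient by 1 + qⁿ. Adjoining the parts of
  -- size n + 1 without and then with overline gives the two recurrences that Shanks's identity
  -- needs.
  O T : ℕ → Series
  O n = cappedSeries (suc (n ℕ.+ n))
  T n = cappedSeries (n ℕ.+ n)

  O0≈1 : O 0 ≈ˢ const 1#
  O0≈1 = coefficientwise λ { zero → refl ; (suc n) → reflexive (≡.cong fromℕ (capped-1-suc n)) }

  O≈ : ∀ n → O (suc n) ≈ˢ T (suc n) +ˢ X ^ suc n *ˢ T (suc n)
  O≈ n = cappedSeries-unfold (suc n , true) (s≤s z≤n) ≡.refl

  T≈ : ∀ n → T (suc n) ≈ˢ O n +ˢ X ^ suc n *ˢ T (suc n)
  T≈ n = ≡.subst (λ j → cappedSeries j ≈ˢ O n +ˢ X ^ suc n *ˢ T (suc n)) (≡.cong suc (≡.sym (ℕ.+-suc n n)))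
    (cappedSeries-unfold (suc n , false) (s≤s z≤n) (≡.cong suc (ℕ.+-suc n n)))

-- The congruence over an abstract ring of characteristic 5.

module Congruence {c ℓ : Level} (R : CommutativeRing c ℓ) where
  open CommutativeRing R
  open import Algebra.Properties.Semiring.Exp semiring using () renaming (_^_ to _^ᴿ_)
  open IntegerSolver R using (fromℕ)
  open Shanks R using (sign; sign-+; sign*sign)
  open PowerSeries R renaming (_^_ to _^ˢ_)
  open ThetaSeries R
  open Overpartitions using (p̄≡capped)
  open OverpartitionSeries R
  open Section R
  open import Relation.Binary.Reasoning.Setoid setoid
  private
    module S = CommutativeRing seriesRing
    module ≈ˢ-Reasoning = Relation.Binary.Reasoning.Setoid S.setoid

  P : Series
  P n = fromℕ (p̄ n)

  θ*P≈1 : θ *ˢ P ≈ˢ const 1#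
  θ*P≈1 = gauss O T O0≈1 O≈ T≈ θ P θ≈partialTheta (λ m≤n → reflexive (≡.cong fromℕ (p̄≡capped m≤n)))

  sign-5* : ∀ n → sign (5 ℕ.* n) ≈ sign n
  sign-5* n = begin
    sign (5 ℕ.* n)                        ≡⟨ ≡.cong sign (solve 1 (λ n → con 5 :* n := n :+ (n :+ n :+ (n :+ n))) ≡.refl n) ⟩
    sign (n ℕ.+ (n ℕ.+ n ℕ.+ (n ℕ.+ n)))  ≈⟨ sign-+ n _ ⟩
    sign n * sign (n ℕ.+ n ℕ.+ (n ℕ.+ n)) ≈⟨ *-congˡ (trans (sign-+ (n ℕ.+ n) (n ℕ.+ n)) (trans (*-cong even even) (*-identityˡ 1#))) ⟩
    sign n * 1#                           ≈⟨ *-identityʳ _ ⟩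
    sign n                                ∎
    where
    open ℕ-Solver.+-*-Solver
    even = trans (sign-+ n n) (sign*sign n)

  module _ (5≈0 : fromℕ 5 ≈ 0#) (fermat : ∀ a → a ^ᴿ 5 ≈ a)
           (r₄-5*ᴿ : ∀ n → fromℕ (r 4 (5 ℕ.* n)) ≈ fromℕ (r 4 n)) where

    section-θ^4 : section (θ ^ˢ 4) ≈ˢ θ ^ˢ 4
    section-θ^4 = coefficientwise λ n → begin
      (θ ^ˢ 4) (5 ℕ.* n)                      ≈⟨ θ-^ 4 (5 ℕ.* n) ⟩
      sign (5 ℕ.* n) * fromℕ (r 4 (5 ℕ.* n))  ≈⟨ *-cong (sign-5* n) (r₄-5*ᴿ n) ⟩
      sign n * fromℕ (r 4 n)                  ≈⟨ θ-^ 4 n ⟨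
      (θ ^ˢ 4) n                              ∎

    section-P : section P ≈ˢ θ ^ˢ 3
    section-P = ≈ˢ.begin
      section P                             ≈ˢ.≈⟨ S.*-identityʳ _ ⟨
      section P *ˢ const 1#                 ≈ˢ.≈⟨ S.*-congˡ θ*P≈1 ⟨
      section P *ˢ (θ *ˢ P)                 ≈ˢ.≈⟨ S.*-assoc _ _ _ ⟨
      section P *ˢ θ *ˢ P                   ≈ˢ.≈⟨ S.*-congʳ (section-*-^5 5≈0 fermat P θ) ⟨
      section (P *ˢ θ ^ˢ 5) *ˢ P            ≈ˢ.≈⟨ S.*-congʳ (section-cong (cancel 4)) ⟩
      section (θ ^ˢ 4) *ˢ P                 ≈ˢ.≈⟨ S.*-congʳ section-θ^4 ⟩
      θ ^ˢ 4 *ˢ P                           ≈ˢ.≈⟨ S.*-comm _ _ ⟩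
      P *ˢ θ ^ˢ 4                           ≈ˢ.≈⟨ cancel 3 ⟩
      θ ^ˢ 3                                ≈ˢ.∎
      where
      module ≈ˢ = ≈ˢ-Reasoning
      cancel : ∀ k → P *ˢ θ ^ˢ suc k ≈ˢ θ ^ˢ k
      cancel k = S.trans (S.sym (S.*-assoc _ _ _)) (S.trans (S.*-congʳ (S.trans (S.*-comm P θ) θ*P≈1)) (S.*-identityˡ _))

    p̄-5* : ∀ n → fromℕ (p̄ (5 ℕ.* n)) ≈ sign n * fromℕ (r 3 n)
    p̄-5* n = trans (coefficient section-P n) (θ-^ 3 n)

-- The integers modulo 5.

infix 4 _≈₅_

-- A record, so that the two sides can be inferred from a proof.
record _≈₅_ (a b : ℤ) : Set where
  constructor mod₅
  field congruence : a ≡ b [mod 5 ]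

open _≈₅_ public

≈₅-reflexive : ∀ {a b} → a ≡ b → a ≈₅ b
≈₅-reflexive {a} ≡.refl = mod₅ (divides 0ℤ (ℤ.+-inverseʳ a))

≈₅-sym : ∀ {a b} → a ≈₅ b → b ≈₅ a
≈₅-sym {a} {b} (mod₅ p) = mod₅ (≡.subst (+ 5 ∣_)
  (solve 2 (λ a b → :- (a :- b) := b :- a) ≡.refl a b) (∣.∣m⇒∣-m p))
  where open +-*-Solver

≈₅-trans : ∀ {a b c} → a ≈₅ b → b ≈₅ c → a ≈₅ c
≈₅-trans {a} {b} {c} (mod₅ p) (mod₅ q) = mod₅ (≡.subst (+ 5 ∣_)
  (solve 3 (λ a b c → (a :- b) :+ (b :- c) := a :- c) ≡.refl a b c) (∣.∣m∣n⇒∣m+n p q))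
  where open +-*-Solver

+-cong₅ : ∀ {a b c d} → a ≈₅ b → c ≈₅ d → a ℤ.+ c ≈₅ b ℤ.+ d
+-cong₅ {a} {b} {c} {d} (mod₅ p) (mod₅ q) = mod₅ (≡.subst (+ 5 ∣_)
  (solve 4 (λ a b c d → (a :- b) :+ (c :- d) := (a :+ c) :- (b :+ d)) ≡.refl a b c d) (∣.∣m∣n⇒∣m+n p q))
  where open +-*-Solver

*-cong₅ : ∀ {a b c d} → a ≈₅ b → c ≈₅ d → a ℤ.* c ≈₅ b ℤ.* d
*-cong₅ {a} {b} {c} {d} (mod₅ p) (mod₅ q) = mod₅ (≡.subst (+ 5 ∣_)
  (solve 4 (λ a b c d → (a :- b) :* c :+ b :* (c :- d) := a :* c :- b :* d) ≡.refl a b c d)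
  (∣.∣m∣n⇒∣m+n (∣.∣m⇒∣m*n c p) (∣.∣n⇒∣m*n b q)))
  where open +-*-Solver

neg-cong₅ : ∀ {a b} → a ≈₅ b → ℤ.- a ≈₅ ℤ.- b
neg-cong₅ {a} {b} (mod₅ p) = mod₅ (≡.subst (+ 5 ∣_) (ℤ.neg-distrib-+ a (ℤ.- b)) (∣.∣m⇒∣-m p))

-- The carrier remains ℤ and only equality is coarsened, so an equation of this ring is already a
-- congruence between integers.
integersMod5 : CommutativeRing 0ℓ 0ℓ
integersMod5 = record
  { Carrier = ℤ ; _≈_ = _≈₅_ ; _+_ = ℤ._+_ ; _*_ = ℤ._*_ ; -_ = ℤ.-_ ; 0# = 0ℤ ; 1# = 1ℤ
  ; isCommutativeRing = record
    { isRing = record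
      { +-isAbelianGroup = record
        { isGroup = record
          { isMonoid = record
            { isSemigroup = record
              { isMagma = record
                { isEquivalence = record { refl = ≈₅-reflexive ≡.refl ; sym = ≈₅-sym ; trans = ≈₅-trans }
                ; ∙-cong = +-cong₅
                }
              ; assoc = λ a b c → ≈₅-reflexive (ℤ.+-assoc a b c)
              }
            ; identity = (λ a → ≈₅-reflexive (ℤ.+-identityˡ a)) , (λ a → ≈₅-reflexive (ℤ.+-identityʳ a))
            }
          ; inverse = (λ a → ≈₅-reflexive (ℤ.+-inverseˡ a)) , (λ a → ≈₅-reflexive (ℤ.+-inverseʳ a))
          ; ⁻¹-cong = neg-cong₅
          }
        ; comm = λ a b → ≈₅-reflexive (ℤ.+-comm a b)
        }
      ; *-cong = *-cong₅
      ; *-assoc = λ a b c → ≈₅-reflexive (ℤ.*-assoc a b c)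
      ; *-identity = (λ a → ≈₅-reflexive (ℤ.*-identityˡ a)) , (λ a → ≈₅-reflexive (ℤ.*-identityʳ a))
      ; distrib = (λ a b c → ≈₅-reflexive (ℤ.*-distribˡ-+ a b c)) , (λ a b c → ≈₅-reflexive (ℤ.*-distribʳ-+ a b c))
      }
    ; *-comm = λ a b → ≈₅-reflexive (ℤ.*-comm a b)
    }
  }

module ℤ₅ = CommutativeRing integersMod5

residue : ∀ a → a ≈₅ + (a %ℕ 5)
residue a = mod₅ (divides (a /ℕ 5) (≡.trans (≡.cong (ℤ._- + (a %ℕ 5)) (a≡a%ℕn+[a/ℕn]*n a 5))
  (solve 2 (λ r q → r :+ q :- r := q) ≡.refl (+ (a %ℕ 5)) (a /ℕ 5 ℤ.* + 5))))
  where open +-*-Solver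

residue-unique : ∀ {r s} → r < 5 → s < 5 → + r ≈₅ + s → r ≡ s
residue-unique {r} {s} r<5 s<5 (mod₅ p) = ℤ.+-injective (ℤ.i-j≡0⇒i≡j (+ r) (+ s) (ℤ.∣i∣≡0⇒i≡0 (∣⇒≡0 (∣.∣⇒∣ᵤ p) small)))
  where
  ∣⇒≡0 : ∀ {n} → 5 ℕ.∣ n → n < 5 → n ≡ 0
  ∣⇒≡0 {zero}  _ _   = ≡.refl
  ∣⇒≡0 {suc n} p n<5 = contradiction p (ℕ.>⇒∤ n<5)
  small : ∣ + r ℤ.- + s ∣ < 5
  small = ℕ.≤-<-trans (≡.subst (λ t → ∣ t ∣ ≤ r ℕ.⊔ s) (≡.sym (ℤ.m-n≡m⊖n r s)) (ℤ.∣m⊝n∣≤m⊔n r s)) (ℕ.⊔-lub r<5 s<5)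

%ℕ-cong : ∀ {a b} → a ≈₅ b → a %ℕ 5 ≡ b %ℕ 5
%ℕ-cong {a} {b} p = residue-unique (n%ℕd<d a 5) (n%ℕd<d b 5)
  (ℤ₅.trans (ℤ₅.sym (residue a)) (ℤ₅.trans p (residue b)))

5*≈0 : ∀ a → + 5 ℤ.* a ≈₅ 0ℤ
5*≈0 a = mod₅ (divides a (≡.trans (ℤ.+-identityʳ (+ 5 ℤ.* a)) (ℤ.*-comm (+ 5) a)))

residueFin : ∀ a → ∃ λ (i : Fin 5) → a ≈₅ + toℕ i
residueFin a = fromℕ< (n%ℕd<d a 5) ,
  ℤ₅.trans (residue a) (ℤ₅.reflexive (≡.cong +_ (≡.sym (toℕ-fromℕ< (n%ℕd<d a 5)))))

-- Double counting modulo 5.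

module DoubleCounting where

  open ≡ using (refl)
  open Algebra.Properties.CommutativeSemigroup ℕ.+-commutativeSemigroup using (x∙yz≈y∙xz)

  module _ {A B : Set} {P : A → B → Set} (P? : ∀ a b → Dec (P a b)) where

    count : List B → A → ℕ
    count bs a = length (filter (P? a) bs)

    sum-count-[] : ∀ as → sum (map (count []) as) ≡ 0
    sum-count-[] []       = refl
    sum-count-[] (_ ∷ as) = sum-count-[] as

    sum-count-∷ : ∀ b bs as → sum (map (count (b ∷ bs)) as) ≡ length (filter (λ a → P? a b) as) ℕ.+ sum (map (count bs) as)
    sum-count-∷ b bs []       = refl
    sum-count-∷ b bs (a ∷ as) = step (P? a b)
      where
      ih = sum-count-∷ b bs as
      step : Dec (P a b) → sum (map (count (b ∷ bs)) (a ∷ as))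
                           ≡ length (filter (λ a → P? a b) (a ∷ as)) ℕ.+ sum (map (count bs) (a ∷ as))
      step (yes p) rewrite List.filter-accept (P? a) {xs = bs} p | List.filter-accept (λ a → P? a b) {xs = as} p | ih =
        ≡.cong suc (x∙yz≈y∙xz (count bs a) (length (filter (λ a → P? a b) as)) (sum (map (count bs) as)))
      step (no ¬p) rewrite List.filter-reject (P? a) {xs = bs} ¬p | List.filter-reject (λ a → P? a b) {xs = as} ¬p | ih =
        x∙yz≈y∙xz (count bs a) (length (filter (λ a → P? a b) as)) (sum (map (count bs) as))

    -- Summing the related pairs by b instead of by a, every b in Q counts 1 modulo 5 and every
    -- other b counts 0. Only the residue of a fibre enters, so fibres of sizes 1 and 6 need no
    -- separate treatment.
    sum-count-mod5 : {Q : B → Set} (Q? : Decidable Q) (as : List A) →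
      (∀ b → Q b → length (filter (λ a → P? a b) as) ℕ.% 5 ≡ 1) →
      (∀ b → ¬ Q b → length (filter (λ a → P? a b) as) ≡ 0) →
      ∀ bs → ∃ λ q → sum (map (count bs) as) ≡ length (filter Q? bs) ℕ.+ q ℕ.* 5
    sum-count-mod5 Q? as one none [] = 0 , sum-count-[] as
    sum-count-mod5 {Q} Q? as one none (b ∷ bs) with q , ih ← sum-count-mod5 Q? as one none bs = step (Q? b)
      where
      hits = length (filter (λ a → P? a b) as)
      step : Dec (Q b) → ∃ λ q → sum (map (count (b ∷ bs)) as) ≡ length (filter Q? (b ∷ bs)) ℕ.+ q ℕ.* 5
      step (yes p) = hits ℕ./ 5 ℕ.+ q , (begin
        sum (map (count (b ∷ bs)) as)                ≡⟨ sum-count-∷ b bs as ⟩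
        hits ℕ.+ sum (map (count bs) as)             ≡⟨ ≡.cong₂ ℕ._+_ (ℕ.m≡m%n+[m/n]*n hits 5) ih ⟩
        hits ℕ.% 5 ℕ.+ hits ℕ./ 5 ℕ.* 5 ℕ.+ (length (filter Q? bs) ℕ.+ q ℕ.* 5)
          ≡⟨ ≡.cong (λ h → h ℕ.+ hits ℕ./ 5 ℕ.* 5 ℕ.+ (length (filter Q? bs) ℕ.+ q ℕ.* 5)) (one b p) ⟩
        1 ℕ.+ hits ℕ./ 5 ℕ.* 5 ℕ.+ (length (filter Q? bs) ℕ.+ q ℕ.* 5)
          ≡⟨ solve 3 (λ h l q → con 1 :+ h :* con 5 :+ (l :+ q :* con 5) := con 1 :+ l :+ (h :+ q) :* con 5) refl (hits ℕ./ 5) _ q ⟩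
        suc (length (filter Q? bs)) ℕ.+ (hits ℕ./ 5 ℕ.+ q) ℕ.* 5
          ≡⟨ ≡.cong (λ ys → length ys ℕ.+ (hits ℕ./ 5 ℕ.+ q) ℕ.* 5) (List.filter-accept Q? p) ⟨
        length (filter Q? (b ∷ bs)) ℕ.+ (hits ℕ./ 5 ℕ.+ q) ℕ.* 5 ∎)
        where open ≡-Reasoning
              open ℕ-Solver.+-*-Solver
      step (no ¬p) = q , (begin
        sum (map (count (b ∷ bs)) as)                ≡⟨ sum-count-∷ b bs as ⟩
        hits ℕ.+ sum (map (count bs) as)             ≡⟨ ≡.cong₂ ℕ._+_ (none b ¬p) ih ⟩
        length (filter Q? bs) ℕ.+ q ℕ.* 5            ≡⟨ ≡.cong (λ ys → length ys ℕ.+ q ℕ.* 5) (List.filter-reject Q? ¬p) ⟨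
        length (filter Q? (b ∷ bs)) ℕ.+ q ℕ.* 5      ∎)
        where open ≡-Reasoning

  sum-constant : ∀ {A : Set} (f : A → ℕ) {c xs} → All (λ x → f x ≡ c) xs → sum (map f xs) ≡ length xs ℕ.* c
  sum-constant f []       = refl
  sum-constant f (p ∷ ps) = ≡.cong₂ ℕ._+_ p (sum-constant f ps)

-- Integer quaternions and the number of representations by four squares.

module Quaternions where

  open ≡ using (refl)
  open import Data.Integer.Base using (_+_; _*_; _-_; -_)
  open DoubleCounting
  open +-*-Solver

  Quaternion : Set
  Quaternion = Vec ℤ 4

  infixl 7 _·_ _∙_

  -- Hamilton's product in the basis 1, i, j, k.
  _·_ : Quaternion → Quaternion → Quaternion
  (a ∷ b ∷ c ∷ d ∷ []) · (w ∷ x ∷ y ∷ z ∷ []) =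
    (a * w - b * x - c * y - d * z) ∷
    (a * x + b * w + c * z - d * y) ∷
    (a * y - b * z + c * w + d * x) ∷
    (a * z + b * y - c * x + d * w) ∷ []

  conj : Quaternion → Quaternion
  conj (a ∷ b ∷ c ∷ d ∷ []) = a ∷ - b ∷ - c ∷ - d ∷ []

  _∙_ : ∀ {k} → ℤ → Vec ℤ k → Vec ℤ k
  m ∙ v = Vec.map (m *_) v

  ∷₄-cong : ∀ {a a′ b b′ c c′ d d′ : ℤ} → a ≡ a′ → b ≡ b′ → c ≡ c′ → d ≡ d′ →
            _≡_ {A = Vec ℤ 4} (a ∷ b ∷ c ∷ d ∷ []) (a′ ∷ b′ ∷ c′ ∷ d′ ∷ [])
  ∷₄-cong refl refl refl refl = refl

  -- Euler's four-square identity.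
  norm-· : ∀ p q → sumOfSquares (p · q) ≡ sumOfSquares p * sumOfSquares q
  norm-· (a ∷ b ∷ c ∷ d ∷ []) (w ∷ x ∷ y ∷ z ∷ []) = solve 8 (λ a b c d w x y z →
    (a :* w :- b :* x :- c :* y :- d :* z) :* (a :* w :- b :* x :- c :* y :- d :* z) :+
    ((a :* x :+ b :* w :+ c :* z :- d :* y) :* (a :* x :+ b :* w :+ c :* z :- d :* y) :+
    ((a :* y :- b :* z :+ c :* w :+ d :* x) :* (a :* y :- b :* z :+ c :* w :+ d :* x) :+
    ((a :* z :+ b :* y :- c :* x :+ d :* w) :* (a :* z :+ b :* y :- c :* x :+ d :* w) :+ con (+ 0))))
    := (a :* a :+ (b :* b :+ (c :* c :+ (d :* d :+ con (+ 0))))) :* (w :* w :+ (x :* x :+ (y :* y :+ (z :* z :+ con (+ 0))))))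
    refl a b c d w x y z

  norm-conj : ∀ p → sumOfSquares (conj p) ≡ sumOfSquares p
  norm-conj (a ∷ b ∷ c ∷ d ∷ []) = solve 4 (λ a b c d →
    a :* a :+ (:- b :* :- b :+ (:- c :* :- c :+ (:- d :* :- d :+ con (+ 0)))) :=
    a :* a :+ (b :* b :+ (c :* c :+ (d :* d :+ con (+ 0))))) refl a b c d

  conj-conj : ∀ p → conj (conj p) ≡ p
  conj-conj (a ∷ b ∷ c ∷ d ∷ []) = ∷₄-cong refl (ℤ.neg-involutive b) (ℤ.neg-involutive c) (ℤ.neg-involutive d)

  ·-∙ : ∀ p m q → p · (m ∙ q) ≡ m ∙ (p · q)
  ·-∙ (a ∷ b ∷ c ∷ d ∷ []) m (w ∷ x ∷ y ∷ z ∷ []) = ∷₄-cong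
    (solve 9 (λ a b c d w x y z m → a :* (m :* w) :- b :* (m :* x) :- c :* (m :* y) :- d :* (m :* z)
              := m :* (a :* w :- b :* x :- c :* y :- d :* z)) refl a b c d w x y z m)
    (solve 9 (λ a b c d w x y z m → a :* (m :* x) :+ b :* (m :* w) :+ c :* (m :* z) :- d :* (m :* y)
              := m :* (a :* x :+ b :* w :+ c :* z :- d :* y)) refl a b c d w x y z m)
    (solve 9 (λ a b c d w x y z m → a :* (m :* y) :- b :* (m :* z) :+ c :* (m :* w) :+ d :* (m :* x)
              := m :* (a :* y :- b :* z :+ c :* w :+ d :* x)) refl a b c d w x y z m)
    (solve 9 (λ a b c d w x y z m → a :* (m :* z) :+ b :* (m :* y) :- c :* (m :* x) :+ d :* (m :* w)
              := m :* (a :* z :+ b :* y :- c :* x :+ d :* w)) refl a b c d w x y z m)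

  -- Associativity and conj p · p = N(p) merged into one identity, checked coordinate by coordinate.
  conj-· : ∀ p q → conj p · (p · q) ≡ sumOfSquares p ∙ q
  conj-· (a ∷ b ∷ c ∷ d ∷ []) (w ∷ x ∷ y ∷ z ∷ []) = ∷₄-cong
    (solve 8 (λ a b c d w x y z →
       a :* (a :* w :- b :* x :- c :* y :- d :* z) :- :- b :* (a :* x :+ b :* w :+ c :* z :- d :* y)
       :- :- c :* (a :* y :- b :* z :+ c :* w :+ d :* x) :- :- d :* (a :* z :+ b :* y :- c :* x :+ d :* w)
       := (a :* a :+ (b :* b :+ (c :* c :+ (d :* d :+ con (+ 0))))) :* w) refl a b c d w x y z)
    (solve 8 (λ a b c d w x y z →
       a :* (a :* x :+ b :* w :+ c :* z :- d :* y) :+ :- b :* (a :* w :- b :* x :- c :* y :- d :* z)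
       :+ :- c :* (a :* z :+ b :* y :- c :* x :+ d :* w) :- :- d :* (a :* y :- b :* z :+ c :* w :+ d :* x)
       := (a :* a :+ (b :* b :+ (c :* c :+ (d :* d :+ con (+ 0))))) :* x) refl a b c d w x y z)
    (solve 8 (λ a b c d w x y z →
       a :* (a :* y :- b :* z :+ c :* w :+ d :* x) :- :- b :* (a :* z :+ b :* y :- c :* x :+ d :* w)
       :+ :- c :* (a :* w :- b :* x :- c :* y :- d :* z) :+ :- d :* (a :* x :+ b :* w :+ c :* z :- d :* y)
       := (a :* a :+ (b :* b :+ (c :* c :+ (d :* d :+ con (+ 0))))) :* y) refl a b c d w x y z)
    (solve 8 (λ a b c d w x y z →
       a :* (a :* z :+ b :* y :- c :* x :+ d :* w) :+ :- b :* (a :* y :- b :* z :+ c :* w :+ d :* x)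
       :- :- c :* (a :* x :+ b :* w :+ c :* z :- d :* y) :+ :- d :* (a :* w :- b :* x :- c :* y :- d :* z)
       := (a :* a :+ (b :* b :+ (c :* c :+ (d :* d :+ con (+ 0))))) :* z) refl a b c d w x y z)

  ·-conj : ∀ p q → p · (conj p · q) ≡ sumOfSquares p ∙ q
  ·-conj p q = begin
    p · (conj p · q)                 ≡⟨ ≡.cong (_· (conj p · q)) (conj-conj p) ⟨
    conj (conj p) · (conj p · q)     ≡⟨ conj-· (conj p) q ⟩
    sumOfSquares (conj p) ∙ q        ≡⟨ ≡.cong (_∙ q) (norm-conj p) ⟩
    sumOfSquares p ∙ q               ∎
    where open ≡-Reasoning

  -- Divisibility by 5 is stated through residues: the predicate is then decidable and has at most
  -- one proof, as counting by a filter requires.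
  Multiple : ∀ {k} → Vec ℤ k → Set
  Multiple = VecAll.All (λ x → x %ℕ 5 ≡ 0)

  multiple? : ∀ {k} → Decidable (Multiple {k})
  multiple? = VecAll.all? (λ x → x %ℕ 5 ℕ.≟ 0)

  multiple-irrelevant : ∀ {k} → Irrelevant (Multiple {k})
  multiple-irrelevant = VecAll.irrelevant ℕ.≡-irrelevant

  multiple-cong : ∀ {k} {v w : Vec ℤ k} → Pointwise _≈₅_ v w → Multiple v → Multiple w
  multiple-cong []       []       = []
  multiple-cong (p ∷ ps) (m ∷ ms) = ≡.trans (≡.sym (%ℕ-cong p)) m ∷ multiple-cong ps ms

  5∙-multiple : ∀ {k} (v : Vec ℤ k) → Multiple (+ 5 ∙ v)
  5∙-multiple []      = []
  5∙-multiple (x ∷ v) = %ℕ-cong (5*≈0 x) ∷ 5∙-multiple v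

  quotient₅ : ∀ {k} → Vec ℤ k → Vec ℤ k
  quotient₅ = Vec.map (_/ℕ 5)

  5∙quotient₅ : ∀ {k} {v : Vec ℤ k} → Multiple v → + 5 ∙ quotient₅ v ≡ v
  5∙quotient₅ []                   = refl
  5∙quotient₅ {v = x ∷ _} (m ∷ ms) = ≡.cong₂ _∷_ (begin
    + 5 * (x /ℕ 5)                ≡⟨ ℤ.*-comm (+ 5) (x /ℕ 5) ⟩
    x /ℕ 5 * + 5                  ≡⟨ ℤ.+-identityˡ _ ⟨
    + 0 + x /ℕ 5 * + 5            ≡⟨ ≡.cong (λ r → + r + x /ℕ 5 * + 5) m ⟨
    + (x %ℕ 5) + x /ℕ 5 * + 5     ≡⟨ a≡a%ℕn+[a/ℕn]*n x 5 ⟨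
    x                             ∎) (5∙quotient₅ ms)
    where open ≡-Reasoning

  5∙-injective : ∀ {k} (v w : Vec ℤ k) → + 5 ∙ v ≡ + 5 ∙ w → v ≡ w
  5∙-injective []      []      _  = refl
  5∙-injective (x ∷ v) (y ∷ w) eq =
    ≡.cong₂ _∷_ (ℤ.*-cancelˡ-≡ (+ 5) x y (Vec.∷-injectiveˡ eq)) (5∙-injective v w (Vec.∷-injectiveʳ eq))

  -- When π has norm 5, v = π u amounts to conj π · v = 5 u.
  LeftDivisible : Quaternion → ℕ → Quaternion → Set
  LeftDivisible π n v = IsRepresentation 4 n v × Multiple (conj π · v)

  leftDivisible? : ∀ π n → Decidable (LeftDivisible π n)
  leftDivisible? π n v = isRepresentation? 4 n v ×-dec multiple? (conj π · v)

  leftDivisible-irrelevant : ∀ π n → Irrelevant (LeftDivisible π n)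
  leftDivisible-irrelevant π n (u , v) (u′ , v′) =
    ≡.cong₂ _,_ (Decidable⇒UIP.≡-irrelevant ℤ._≟_ u u′) (multiple-irrelevant v v′)

  module _ (π : Quaternion) (norm≡5 : sumOfSquares π ≡ + 5) (n : ℕ) where

    -- The maps are v ↦ (conj π · v) / 5 and u ↦ π · u. Since π · conj π and conj π · π both act as
    -- 5, the composites become identities after multiplication by 5, which is injective;
    -- multiplicativity of the norm exchanges 5n and n.
    leftDivisible↔representation : ∃ (LeftDivisible π (5 ℕ.* n)) ↔ Representation 4 n
    leftDivisible↔representation = mk↔ₛ′ to from to∘from from∘to
      where
      open ≡-Reasoning

      divide : Quaternion → Quaternion
      divide v = quotient₅ (conj π · v)

      π·divide : ∀ v → Multiple (conj π · v) → π · divide v ≡ v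
      π·divide v m = 5∙-injective _ _ (begin
        + 5 ∙ (π · divide v)       ≡⟨ ·-∙ π (+ 5) (divide v) ⟨
        π · (+ 5 ∙ divide v)       ≡⟨ ≡.cong (π ·_) (5∙quotient₅ m) ⟩
        π · (conj π · v)           ≡⟨ ·-conj π v ⟩
        sumOfSquares π ∙ v         ≡⟨ ≡.cong (_∙ v) norm≡5 ⟩
        + 5 ∙ v                    ∎)

      conjπ·π : ∀ u → conj π · (π · u) ≡ + 5 ∙ u
      conjπ·π u = ≡.trans (conj-· π u) (≡.cong (_∙ u) norm≡5)

      norm-π· : ∀ u → sumOfSquares (π · u) ≡ + 5 * sumOfSquares u
      norm-π· u = ≡.trans (norm-· π u) (≡.cong (_* sumOfSquares u) norm≡5)

      multiple-π· : ∀ u → Multiple (conj π · (π · u))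
      multiple-π· u = ≡.subst Multiple (≡.sym (conjπ·π u)) (5∙-multiple u)

      to : ∃ (LeftDivisible π (5 ℕ.* n)) → Representation 4 n
      to (v , eq , m) = divide v , ℤ.*-cancelˡ-≡ (+ 5) _ _ (begin
        + 5 * sumOfSquares (divide v)    ≡⟨ norm-π· (divide v) ⟨
        sumOfSquares (π · divide v)      ≡⟨ ≡.cong sumOfSquares (π·divide v m) ⟩
        sumOfSquares v                   ≡⟨ eq ⟩
        + (5 ℕ.* n)                      ≡⟨ ℤ.pos-* 5 n ⟩
        + 5 * + n                        ∎)

      from : Representation 4 n → ∃ (LeftDivisible π (5 ℕ.* n))
      from (u , eq) = π · u , ≡.trans (norm-π· u) (≡.trans (≡.cong (+ 5 *_) eq) (≡.sym (ℤ.pos-* 5 n))) , multiple-π· u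

      to∘from : ∀ y → to (from y) ≡ y
      to∘from (u , eq) = Σ-≡ (5∙-injective _ _ (≡.trans (5∙quotient₅ (multiple-π· u)) (conjπ·π u)))
        where
        Σ-≡ : ∀ {x y : Representation 4 n} → proj₁ x ≡ proj₁ y → x ≡ y
        Σ-≡ {_ , p} {_ , q} refl = ≡.cong (_ ,_) (Decidable⇒UIP.≡-irrelevant ℤ._≟_ p q)

      from∘to : ∀ x → from (to x) ≡ x
      from∘to (v , eq , m) = Σ-≡ (π·divide v m)
        where
        Σ-≡ : ∀ {x y : ∃ (LeftDivisible π (5 ℕ.* n))} → proj₁ x ≡ proj₁ y → x ≡ y
        Σ-≡ {_ , p} {_ , q} refl = ≡.cong (_ ,_) (leftDivisible-irrelevant π (5 ℕ.* n) p q)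

    leftDivisible-count : let m = 5 ℕ.* n in
      length (filter (leftDivisible? π m) (vectors 4 (integersUpTo m))) ≡ r 4 n
    leftDivisible-count = ↔⇒≡ (↔-trans
      (filter-counts (leftDivisible? π m) (leftDivisible-irrelevant π m) (vectors-unique 4 (integersUpTo-unique m))
        λ { {v} (eq , _) → ∈-vectors v (ℕ.≤-reflexive (ℤ.+-injective (≡.trans (≡.sym (sumOfSquares-ℕ v)) eq))) })
      (↔-trans leftDivisible↔representation (↔-sym (r-counts 4 n))))
      where m = 5 ℕ.* n

  -- One quaternion of norm 5 from each class modulo right multiplication by the eight units ±1, ±i, ±j, ±k.
  πs : List Quaternion
  πs = (+ 1 ∷ + 2 ∷ + 0 ∷ + 0 ∷ []) ∷ (+ 1 ∷ - + 2 ∷ + 0 ∷ + 0 ∷ [])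
     ∷ (+ 1 ∷ + 0 ∷ + 2 ∷ + 0 ∷ []) ∷ (+ 1 ∷ + 0 ∷ - + 2 ∷ + 0 ∷ [])
     ∷ (+ 1 ∷ + 0 ∷ + 0 ∷ + 2 ∷ []) ∷ (+ 1 ∷ + 0 ∷ + 0 ∷ - + 2 ∷ []) ∷ []

  πs-norm : All (λ π → sumOfSquares π ≡ + 5) πs
  πs-norm = refl ∷ refl ∷ refl ∷ refl ∷ refl ∷ refl ∷ []

  divisors : Quaternion → ℕ
  divisors v = length (filter (λ π → multiple? (conj π · v)) πs)

  -- A nonzero isotropic quaternion modulo 5 has exactly one of the π as a left divisor, and zero has all six.
  divisors-residues : ∀ (a b c d : Fin 5) → let v = + toℕ a ∷ + toℕ b ∷ + toℕ c ∷ + toℕ d ∷ [] in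
                      sumOfSquares v %ℕ 5 ≡ 0 → divisors v ℕ.% 5 ≡ 1
  -- Decided by evaluation on all 5⁴ residue vectors.
  divisors-residues = toWitness {a? = Fin.all? λ a → Fin.all? λ b → Fin.all? λ c → Fin.all? λ d →
    (_ ℕ.≟ 0) →-dec (_ ℕ.≟ 1)} _

  ·-congʳ : ∀ p {v w} → Pointwise _≈₅_ v w → Pointwise _≈₅_ (p · v) (p · w)
  ·-congʳ (a ∷ b ∷ c ∷ d ∷ []) (w ∷ x ∷ y ∷ z ∷ []) =
    (a ✶ w ⊟ b ✶ x ⊟ c ✶ y ⊟ d ✶ z) ∷ (a ✶ x ⊞ b ✶ w ⊞ c ✶ z ⊟ d ✶ y) ∷
    (a ✶ y ⊟ b ✶ z ⊞ c ✶ w ⊞ d ✶ x) ∷ (a ✶ z ⊞ b ✶ y ⊟ c ✶ x ⊞ d ✶ w) ∷ []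
    where
    infixl 7 _✶_
    infixl 6 _⊞_ _⊟_
    _✶_ : ∀ a {x y} → x ≈₅ y → a * x ≈₅ a * y
    a ✶ p = *-cong₅ (ℤ₅.refl {a}) p
    _⊞_ : ∀ {a b c d} → a ≈₅ b → c ≈₅ d → a + c ≈₅ b + d
    _⊞_ = ℤ₅.+-cong
    _⊟_ : ∀ {a b c d} → a ≈₅ b → c ≈₅ d → a - c ≈₅ b - d
    p ⊟ q = ℤ₅.+-cong p (ℤ₅.-‿cong q)

  sumOfSquares-cong : ∀ {k} {v w : Vec ℤ k} → Pointwise _≈₅_ v w → sumOfSquares v ≈₅ sumOfSquares w
  sumOfSquares-cong []       = ℤ₅.refl
  sumOfSquares-cong (p ∷ ps) = ℤ₅.+-cong (ℤ₅.*-cong p p) (sumOfSquares-cong ps)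

  divisors-cong : ∀ {v w} → Pointwise _≈₅_ v w → divisors v ≡ divisors w
  divisors-cong {v} {w} p = ≡.cong length (List.filter-≐ (λ π → multiple? (conj π · v)) (λ π → multiple? (conj π · w))
    ( (λ {π} → multiple-cong (·-congʳ (conj π) p))
    , (λ {π} → multiple-cong (Pointwise.sym ℤ₅.sym (·-congʳ (conj π) p)))) πs)

  divisors%5 : ∀ n v → IsRepresentation 4 (5 ℕ.* n) v → divisors v ℕ.% 5 ≡ 1
  divisors%5 n v@(a ∷ b ∷ c ∷ d ∷ []) eq
    with i , a≈i ← residueFin a | j , b≈j ← residueFin b | k , c≈k ← residueFin c | l , d≈l ← residueFin d =
    ≡.trans (≡.cong (ℕ._% 5) (divisors-cong v≈w)) (divisors-residues i j k l
      (%ℕ-cong (ℤ₅.trans (ℤ₅.sym (sumOfSquares-cong v≈w))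
        (ℤ₅.trans (ℤ₅.reflexive (≡.trans eq (ℤ.pos-* 5 n))) (5*≈0 (+ n))))))
    where
    v≈w = a≈i ∷ b≈j ∷ c≈k ∷ d≈l ∷ []

  -- Because 6 ≡ 1 modulo 5; explicitly a - b = 5 (b - q). The 6 is the length of `πs`.
  ≈₅-from-6* : ∀ a b q → a ℕ.+ q ℕ.* 5 ≡ 6 ℕ.* b → + a ≈₅ + b
  ≈₅-from-6* a b q eq = mod₅ (divides (+ b - + q) (begin
    + a - + b
      ≡⟨ solve 3 (λ a b q → a :- b := a :+ q :* con (+ 5) :- b :- q :* con (+ 5)) refl (+ a) (+ b) (+ q) ⟩
    + a + + q * + 5 - + b - + q * + 5
      ≡⟨ ≡.cong (λ t → t - + b - + q * + 5) total ⟩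
    + 6 * + b - + b - + q * + 5
      ≡⟨ solve 2 (λ b q → con (+ 6) :* b :- b :- q :* con (+ 5) := (b :- q) :* con (+ 5)) refl (+ b) (+ q) ⟩
    (+ b - + q) * + 5 ∎))
    where
    open ≡-Reasoning
    total : + a + + q * + 5 ≡ + 6 * + b
    total = ≡.trans (≡.cong (λ t → + a + t) (≡.sym (ℤ.pos-* q 5))) (≡.trans (≡.cong +_ eq) (ℤ.pos-* 6 b))

  -- The pairs (π, v) with π a left divisor of v of norm 5n are counted twice: each π accounts for
  -- `r 4 n` of them, each v for a number that is 1 modulo 5.
  r₄-5* : ∀ n → + r 4 (5 ℕ.* n) ≈₅ + r 4 n
  r₄-5* n = ≈₅-from-6* _ _ (proj₁ counted) (≡.trans (≡.sym (proj₂ counted))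
    (sum-constant _ (All.map (λ {π} norm≡5 → leftDivisible-count π norm≡5 n) πs-norm)))
    where
    one : ∀ v → IsRepresentation 4 (5 ℕ.* n) v → length (filter (λ π → leftDivisible? π (5 ℕ.* n) v) πs) ℕ.% 5 ≡ 1
    one v rep = ≡.trans (≡.cong (λ ys → length ys ℕ.% 5)
      (List.filter-≐ (λ π → leftDivisible? π (5 ℕ.* n) v) (λ π → multiple? (conj π · v)) (proj₂ , (rep ,_)) πs)) (divisors%5 n v rep)

    -- `LeftDivisible` includes the norm condition, so the remaining vectors of the search box
    -- contribute nothing.
    none : ∀ v → ¬ IsRepresentation 4 (5 ℕ.* n) v → length (filter (λ π → leftDivisible? π (5 ℕ.* n) v) πs) ≡ 0
    none v ¬rep = ≡.cong length (List.filter-none (λ π → leftDivisible? π (5 ℕ.* n) v) {xs = πs} (All.tabulate λ _ → ¬rep ∘ proj₁))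

    counted = sum-count-mod5 (λ π → leftDivisible? π (5 ℕ.* n)) (isRepresentation? 4 (5 ℕ.* n)) πs
      one none (vectors 4 (integersUpTo (5 ℕ.* n)))

-- Specialisation to the integers modulo 5.

open Quaternions using (r₄-5*)
open Shanks integersMod5 using (sign)
open IntegerSolver integersMod5 using (fromℕ)
open import Algebra.Properties.Semiring.Mult.TCOptimised (CommutativeRing.semiring integersMod5) using (1+×)
open import Algebra.Properties.Semiring.Exp (CommutativeRing.semiring integersMod5) using (^-congˡ) renaming (_^_ to _^₅_)

fromℕ≈+ : ∀ n → fromℕ n ≈₅ + n
fromℕ≈+ zero    = ℤ₅.refl
fromℕ≈+ (suc n) = ℤ₅.trans (1+× n (+ 1)) (+-cong₅ (ℤ₅.refl {+ 1}) (fromℕ≈+ n))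

sign≈-1^ : ∀ n → sign n ≈₅ -1ℤ ℤ.^ n
sign≈-1^ zero    = ℤ₅.refl
sign≈-1^ (suc n) = ℤ₅.trans (ℤ₅.-‿cong (sign≈-1^ n)) (ℤ₅.reflexive (≡.sym (ℤ.-1*i≡-i (-1ℤ ℤ.^ n))))

fermat : ∀ a → a ^₅ 5 ≈₅ a
fermat a with i , a≈i ← residueFin a = ℤ₅.trans (^-congˡ 5 a≈i) (ℤ₅.trans (residues i) (ℤ₅.sym a≈i))
  where
  residues : ∀ (i : Fin 5) → (+ toℕ i) ^₅ 5 ≈₅ + toℕ i
  residues i = mod₅ (toWitness {a? = Fin.all? λ i → + 5 ∣.∣? ((+ toℕ i) ^₅ 5 ℤ.- + toℕ i)} _ i)

open import Data.Nat.Base using (ℕ; _≥_) renaming (_*_ to _*ℕ_)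
open import Data.Integer.Base using (+_; -1ℤ; _*_; _^_)

theorem1 : (n : ℕ) → n ≥ 1 →
    + p̄ (5 *ℕ n) ≡ -1ℤ ^ n * + r 3 n [mod 5 ]
theorem1 n _ = congruence (ℤ₅.trans (ℤ₅.sym (fromℕ≈+ (p̄ (5 *ℕ n)))) (ℤ₅.trans
  (Congruence.p̄-5* integersMod5 (mod₅ (divides (+ 1) ≡.refl)) fermat
    (λ m → ℤ₅.trans (fromℕ≈+ (r 4 (5 *ℕ m))) (ℤ₅.trans (r₄-5* m) (ℤ₅.sym (fromℕ≈+ (r 4 m))))) n)
  (ℤ₅.*-cong (sign≈-1^ n) (fromℕ≈+ (r 3 n)))))
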